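{- Let $G$ be a ($C_4$, prism)-free perfect graph and let $(H,v)$ be a line wheel in $G$ with $H=a\hbox{ - }b\hbox{ - }\dots\hbox{ - }c\hbox{ - }d\hbox{ - }\dots\hbox{ - }a$ and $N(v)\cap V(H)=\{a,b,c,d\}$. Let $P$ be the path in $H\setminus b$ from $a$ to $d$, and let $Q$ be the path in $H\setminus a$ from $b$ to $c$. Then $v$ has a neighbor in every path from $P\setminus a$ to $Q\setminus c$ and in every path from $P\setminus d$ to $Q\setminus b$. In particular, $v$ breaks each of the sets $\{a\}\cup Q^*$, $\{d\}\cup Q^*$, $\{b\}\cup P^*$ and $\{c\}\cup P^*$.
   Context: All graphs finite and simple; paths are induced paths; for a path $R$ with ends $x,y$, $R^*=V(R)\setminus\{x,y\}$. A hole is an induced cycle of length at least 4; $C_4$ is the hole of length 4. A prism is two vertex-disjoint triangles $\{a_1,a_2,a_3\}$, $\{b_1,b_2,b_3\}$ with three vertex-disjoint paths $P_i$ from $a_i$ to $b_i$ such that for $i<j$ the only edges between $V(P_i)$ and $V(P_j)$ are $a_ia_j,b_ib_j$. A wheel $(H,v)$ is a hole $H$ and a vertex $v$ with at least three neighbors in $H$; a sector is a subpath of $H$ of length $\ge1$ whose ends are adjacent to $v$ and whose interior is anticomplete to $v$; short if of length 1. A line wheel is a wheel with exactly four sectors, exactly two of which are short, the two short sectors having no common vertex. For disjoint, mutually anticomplete $A,B\subseteq V(G)$, a path from $A$ to $B$ is a minimal path $x_1\hbox{ - }\dots\hbox{ - }x_n$ in $G\setminus(A\cup B)$ such that $x_1$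 has a neighbor in $A$ and $x_n$ has a neighbor in $B$. For $X\subseteq V(G)$, $N[X]$ is $X$ together with all vertices having a neighbor in $X$. For $Y\subseteq V(G)$ and $u\notin Y$, $u$ breaks $Y$ if for every connected component $D$ of $G\setminus N[u]$, $Y\not\subseteq N[D]$.
   Formalization: "v has a neighbor in every path" is stated for paths not containing v: the one-vertex path consisting of v alone is itself a minimal path between the two sets and contains no neighbor of v, and by minimality it is the only path excluded. -}

module Defs where

open import Data.Nat.Base using (ℕ; _≤_; _<_)
open import Data.Fin.Base as Fin using (Fin)
open import Data.Fin.Subset using (Subset; ∣_∣; Nonempty) renaming (_∈_ to _∈ˢ_; _⊆_ to _⊆ˢ_)
open import Data.List.Base using (List; []; _∷_; _++_; _∷ʳ_; length; filter; head; last)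
open import Data.List.Membership.Propositional using (_∈_)
open import Data.List.Relation.Binary.Disjoint.Propositional using (Disjoint)
open import Data.List.Relation.Binary.Infix.Heterogeneous using (Infix)
open import Data.List.Relation.Unary.All using (All)
open import Data.List.Relation.Unary.Unique.Propositional using (Unique)
open import Data.Maybe.Base using (just)
open import Data.Product.Base using (_×_; Σ-syntax; ∃-syntax; ∃₂)
open import Data.Sum.Base using (_⊎_)
open import Function.Bundles using (_⇔_)
open import Level using (0ℓ)
open import Relation.Binary.Core using (Rel)
open import Relation.Binary.Construct.Closure.ReflexiveTransitive using (Star)
open import Relation.Binary.Definitions using (Decidable; Symmetric; Irreflexive)
open import Relation.Binary.PropositionalEquality.Core using (_≡_; _≢_)
open import Relation.Nullary.Negation.Core using (¬_)
open import Relation.Unary using (Pred; _∪_; _∖_; ∁; _⊆_; ｛_｝)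

record Graph (n : ℕ) : Set₁ where
  infix 4 _~_ _~?_
  field
    _~_      : Rel (Fin n) 0ℓ
    _~?_     : Decidable _~_
    ~-sym    : Symmetric _~_
    ~-irrefl : Irreflexive _≡_ _~_

-- Paths and holes are the lists of their vertices, in order; a hole is listed
-- once around, starting anywhere and in either direction.
Vertices : ∀ {n} → List (Fin n) → Pred (Fin n) 0ℓ
Vertices xs = _∈ xs

-- R* for a path R with ends x and y.
Interior : ∀ {n} → Fin n → Fin n → List (Fin n) → Pred (Fin n) 0ℓ
Interior x y R = Vertices R ∖ (｛ x ｝ ∪ ｛ y ｝)

Contiguous : ∀ {n} → List (Fin n) → List (Fin n) → Set
Contiguous = Infix _≡_

module _ {n : ℕ} (G : Graph n) where
  open Graph G

  private
    V : Set
    V = Fin n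

  HasNeighbourIn : V → Pred V 0ℓ → Set
  HasNeighbourIn x X = ∃[ y ] X y × x ~ y

  N[_] : Pred V 0ℓ → Pred V 0ℓ
  N[ X ] x = X x ⊎ HasNeighbourIn x X

  -- R is an induced path from x to y (of length length R ∸ 1, possibly 0).
  record IsPath (x y : V) (R : List V) : Set where
    field
      starts  : head R ≡ just x
      ends    : last R ≡ just y
      unique  : Unique R
      induced : ∀ {u w} → u ∈ R → w ∈ R →
                u ~ w ⇔ (Contiguous (u ∷ w ∷ []) R ⊎ Contiguous (w ∷ u ∷ []) R)

  -- The contiguous pairs of H ++ H are the cyclically consecutive pairs of H.
  record IsHole (H : List V) : Set where
    field
      long    : 4 ≤ length H
      unique  : Unique H
      induced : ∀ {u w} → u ∈ H → w ∈ H →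
                u ~ w ⇔ (Contiguous (u ∷ w ∷ []) (H ++ H) ⊎ Contiguous (w ∷ u ∷ []) (H ++ H))

  C₄-free : Set
  C₄-free = ∀ H → IsHole H → length H ≢ 4

  record Prism : Set where
    field
      a b       : Fin 3 → V
      P         : Fin 3 → List V
      triangleᵃ : ∀ {i j} → i ≢ j → a i ~ a j
      triangleᵇ : ∀ {i j} → i ≢ j → b i ~ b j
      a≢b       : ∀ i j → a i ≢ b j
      path      : ∀ i → IsPath (a i) (b i) (P i)
      disjoint  : ∀ {i j} → i Fin.< j → Disjoint (P i) (P j)
      onlyEdges : ∀ {i j} → i Fin.< j → ∀ {x y} → x ∈ P i → y ∈ P j → x ~ y →
                  (x ≡ a i × y ≡ a j) ⊎ (x ≡ b i × y ≡ b j)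

  Prism-free : Set
  Prism-free = ¬ Prism

  IsClique : Subset n → Set
  IsClique K = ∀ {x y} → x ∈ˢ K → y ∈ˢ K → x ≢ y → x ~ y

  -- k is the clique number of the subgraph induced by S.
  IsCliqueNumber : Subset n → ℕ → Set
  IsCliqueNumber S k =
    (∃[ K ] K ⊆ˢ S × IsClique K × ∣ K ∣ ≡ k) ×
    (∀ K → K ⊆ˢ S → IsClique K → ∣ K ∣ ≤ k)

  -- The subgraph induced by S is k-colourable. Only vertices of S need a colour
  -- below k, so the empty subgraph is 0-colourable.
  Colourable : Subset n → ℕ → Set
  Colourable S k = Σ[ f ∈ (V → ℕ) ]
    (∀ {x} → x ∈ˢ S → f x < k) ×
    (∀ {x y} → x ∈ˢ S → y ∈ˢ S → x ~ y → f x ≢ f y)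

  IsChromaticNumber : Subset n → ℕ → Set
  IsChromaticNumber S k = Colourable S k × (∀ j → Colourable S j → k ≤ j)

  Perfect : Set
  Perfect = ∀ S → ∃[ k ] IsChromaticNumber S k × IsCliqueNumber S k

  record IsWheel (H : List V) (v : V) : Set where
    field
      hole       : IsHole H
      neighbours : 3 ≤ length (filter (v ~?_) H)

  -- A subpath of the hole H is listed in the direction in which H is listed;
  -- that makes its list unique, so that sectors can be counted as lists.
  IsSector : List V → V → List V → Set
  IsSector H v S = Contiguous S (H ++ H) ×
    ∃₂ λ x y → ∃[ xs ] S ≡ x ∷ (xs ∷ʳ y) × IsPath x y S ×
      v ~ x × v ~ y × All (λ w → ¬ v ~ w) xs

  Short : List V → Set
  Short S = length S ≡ 2

  -- S₁ and S₂ are the short sectors, L₁ and L₂ the other two.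
  record IsLineWheel (H : List V) (v : V) : Set where
    field
      wheel       : IsWheel H v
      S₁ S₂ L₁ L₂ : List V
      distinct    : Unique (S₁ ∷ S₂ ∷ L₁ ∷ L₂ ∷ [])
      sectors     : ∀ S → IsSector H v S ⇔ S ∈ (S₁ ∷ S₂ ∷ L₁ ∷ L₂ ∷ [])
      short₁      : Short S₁
      short₂      : Short S₂
      long₁       : ¬ Short L₁
      long₂       : ¬ Short L₂
      disjoint    : Disjoint S₁ S₂

  record Links (A B : Pred V 0ℓ) (R : List V) : Set where
    field
      {x y}   : V
      path    : IsPath x y R
      outside : Vertices R ⊆ ∁ (A ∪ B)
      from    : HasNeighbourIn x A
      to      : HasNeighbourIn y B

  -- R is a path from the set A to the set B. For induced paths, minimality under
  -- inclusion of vertex sets is minimality under taking subpaths.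
  IsPathBetween : (A B : Pred V 0ℓ) → List V → Set
  IsPathBetween A B R = Links A B R ×
    (∀ R′ → Links A B R′ → Vertices R′ ⊆ Vertices R → Vertices R ⊆ Vertices R′)

  Connected : Subset n → Set
  Connected D = ∀ {x y} → x ∈ˢ D → y ∈ˢ D → Star (λ u w → u ∈ˢ D × w ∈ˢ D × u ~ w) x y

  -- D is (the vertex set of) a connected component of the subgraph induced by W.
  record IsComponent (W : Pred V 0ℓ) (D : Subset n) : Set where
    field
      inside    : (_∈ˢ D) ⊆ W
      nonempty  : Nonempty D
      connected : Connected D
      maximal   : ∀ E → (_∈ˢ E) ⊆ W → Connected E → D ⊆ˢ E → E ⊆ˢ D

  Breaks : V → Pred V 0ℓ → Set
  Breaks u Y = ¬ Y u ×
    (∀ D → IsComponent (∁ N[ ｛ u ｝ ]) D → ¬ (Y ⊆ N[ (_∈ˢ D) ]))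

module Submission where

-- Every triangle-free induced subgraph of a perfect graph is 2-colourable, so all
-- holes are even. Suppose that R joins P ∖ a to Q ∖ c away from N[ v ], with only
-- its end x having neighbours in P ∖ a and only its end y in Q ∖ c. If a had no
-- neighbour in R, then R continued along Q to b would attach to the hole P ∪ v at
-- x and at the edge va: this gives an odd hole, or a prism if x has exactly two
-- neighbours in P and they are adjacent. So a, and by symmetry c, has a neighbour
-- in R, and no vertex of R sees both because of C₄. A shortest segment of R
-- between them closes with v to a hole and is thus odd; if it missed x, it would
-- close with P to an odd hole. Hence it is all of R. If a sees x and c sees y,
-- parity leaves x only a and its successor on P, likewise y, and R, P ∖ a with c
-- and Q ∖ c with a form a prism. If a sees y and c sees x, parity leaves x only d
-- on P and y only b on Q, and P, Q, R form a prism.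

-- Parities count vertices, so an even hole is used as two paths whose vertex counts have the same
-- parity. `P` is odd because it closes with `v`. When `a` misses `R`, what matters of `x` is its
-- first and its last neighbour on `P`: unless these are consecutive, parity alone is contradictory.
-- Two consecutive ones form a triangle with `x`; there parity is silent and prism-freeness has to
-- take over. A connecting path found inside a component of G minus N[v] may run through `P` and `Q`
-- and touch them many times. It is therefore measured by the closed neighbourhoods of `P` minus `a`
-- and `Q` minus `c` and cut down to a shortest piece between them, which makes both conclusions
-- instances of one statement. The edges from `a` and `c` to `R` stay unrestricted by this
-- reduction, and the cases are about where they attach. A half turn exchanging `P` and `Q`
-- transfers each argument about `x` to `y`; a reflection exchanging `a` with `d` and `b` with `c`
-- supplies the other half of each conclusion.

open import Defs
open import Data.Bool.Base using (Bool; true; false; not; _xor_)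
open import Data.Bool.Properties using (xor-comm; not-involutive; not-¬)
open import Data.Empty using (⊥; ⊥-elim)
open import Data.Fin.Base using (Fin; zero; suc)
open import Data.Fin.Properties using (_≟_)
open import Data.Fin.Subset using (Subset; inside; outside; ∣_∣; ⁅_⁆)
  renaming (_∈_ to _∈ˢ_; _⊆_ to _⊆ˢ_; _∪_ to _∪ˢ_; ⊥ to ∅ˢ)
open import Data.Fin.Subset.Properties using (x∈⁅x⁆; x∈⁅y⁆⇒x≡y; x∈p∪q⁻; x∈p∪q⁺; ∉⊥)
open import Data.List.Base using (List; []; _∷_; _++_; _∷ʳ_; head; last; reverse)
open import Data.List.Membership.Propositional using (_∈_; _∉_; find; lose)
open import Data.List.Membership.Propositional.Properties using (∈-++⁺ˡ; ∈-++⁺ʳ; ∈-++⁻; ∈-∃++)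
import Data.List.Membership.DecPropositional as DecMembership
open import Data.List.Properties using (unfold-reverse; ++-assoc)
open import Data.List.Relation.Binary.Disjoint.Propositional using (Disjoint)
open import Data.List.Relation.Binary.Infix.Heterogeneous using (Infix; here; there; _++ⁱ_; _ⁱ++_)
open import Data.List.Relation.Binary.Prefix.Heterogeneous using ([]; _∷_)
open import Data.List.Relation.Unary.All as All using (All; []; _∷_)
open import Data.List.Relation.Unary.All.Properties using (All¬⇒¬Any; ¬Any⇒All¬; ++⁺; ++⁻ˡ; ++⁻ʳ)
open import Data.List.Relation.Unary.AllPairs using ([]; _∷_)
open import Data.List.Relation.Unary.Any as Any using (Any; here; there; any?)
open import Data.List.Relation.Unary.Any.Properties using (reverse⁺; reverse⁻)
open import Data.List.Relation.Unary.Unique.Propositional using (Unique)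
open import Data.Maybe.Base using (just)
open import Data.Maybe.Properties using (just-injective)
open import Data.Nat.Base using (ℕ; zero; suc; _≤_; _<_; s≤s)
open import Data.Nat.Properties using (<-≤-trans; ≤-refl; ≰⇒>; _≤?_)
open import Data.Product.Base using (Σ-syntax; ∃-syntax; _×_; _,_; proj₁; proj₂)
open import Data.Sum.Base using (_⊎_; inj₁; inj₂; [_,_]′; swap)
open import Data.Vec.Base using ([]; _∷_; here; there)
open import Function.Base using (_∘_; id)
open import Function.Bundles using (_⇔_; mk⇔; Equivalence)
open import Level using (0ℓ)
open import Relation.Binary.Construct.Closure.ReflexiveTransitive using (Star; ε; _◅_)
open import Relation.Binary.PropositionalEquality using (_≡_; _≢_; refl; sym; trans; cong; subst)
open import Relation.Nullary using (¬_; yes; no; contradiction; ¬?; _×-dec_; _⊎-dec_)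
open import Relation.Unary using (Pred; Decidable; _⊆_; _∪_; _∖_; ∁; ｛_｝)

-- Lists

odd : ∀ {A : Set} → List A → Bool
odd []       = false
odd (_ ∷ xs) = not (odd xs)

odd-++ : ∀ {A : Set} (xs ys : List A) → odd (xs ++ ys) ≡ odd xs xor odd ys
odd-++ []       ys = refl
odd-++ (x ∷ xs) ys rewrite odd-++ xs ys with odd xs | odd ys
... | true  | true  = refl
... | true  | false = refl
... | false | _     = refl

odd-∷ʳ : ∀ {A : Set} (xs : List A) x → odd (xs ∷ʳ x) ≡ not (odd xs)
odd-∷ʳ []       x = refl
odd-∷ʳ (_ ∷ xs) x = cong not (odd-∷ʳ xs x)

∈-∷ʳ⁻ : ∀ {A : Set} (xs : List A) {x y} → y ∈ xs ∷ʳ x → y ∈ xs ⊎ y ≡ x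
∈-∷ʳ⁻ xs i with ∈-++⁻ xs i
... | inj₁ j        = inj₁ j
... | inj₂ (here e) = inj₂ e

∈-∷ʳ⁺ : ∀ {A : Set} (xs : List A) {x} → x ∈ xs ∷ʳ x
∈-∷ʳ⁺ xs = ∈-++⁺ʳ xs (here refl)

++-⊆ʳ : ∀ {A : Set} {zs : List A} (xs : List A) {ys} → zs ≡ xs ++ ys → ∀ {x} → x ∈ ys → x ∈ zs
++-⊆ʳ xs refl = ∈-++⁺ʳ xs

∷ʳ-⊆ : ∀ {A : Set} {zs : List A} (xs : List A) {y ys} → zs ≡ xs ++ y ∷ ys → ∀ {x} → x ∈ xs ∷ʳ y → x ∈ zs
∷ʳ-⊆ xs refl i with ∈-∷ʳ⁻ xs i
... | inj₁ j    = ∈-++⁺ˡ j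
... | inj₂ refl = ∈-++⁺ʳ xs (here refl)

last-just : ∀ {A : Set} x (xs : List A) → ∃[ e ] last (x ∷ xs) ≡ just e
last-just x []       = x , refl
last-just x (y ∷ xs) = last-just y xs

last⇒∈ : ∀ {A : Set} (xs : List A) {e} → last xs ≡ just e → e ∈ xs
last⇒∈ (x ∷ [])     refl = here refl
last⇒∈ (x ∷ y ∷ xs) eq   = there (last⇒∈ (y ∷ xs) eq)

contiguous-join : ∀ {A : Set} (xs : List A) {u w ys} → last xs ≡ just u → Infix _≡_ (u ∷ w ∷ []) (xs ++ w ∷ ys)
contiguous-join (x ∷ [])     refl = here (refl ∷ refl ∷ [])
contiguous-join (x ∷ y ∷ xs) eq   = there (contiguous-join (y ∷ xs) eq)

contiguous-∈ : ∀ {A : Set} {u w : A} {xs} → Infix _≡_ (u ∷ w ∷ []) xs → u ∈ xs × w ∈ xs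
contiguous-∈ (here (refl ∷ refl ∷ _)) = here refl , there (here refl)
contiguous-∈ (there c)                = there (proj₁ (contiguous-∈ c)) , there (proj₂ (contiguous-∈ c))

contiguous-second∈ : ∀ {A : Set} {u w x : A} {xs} → Infix _≡_ (u ∷ w ∷ []) (x ∷ xs) → w ∈ xs
contiguous-second∈ (here (_ ∷ refl ∷ [])) = here refl
contiguous-second∈ (there c)              = proj₂ (contiguous-∈ c)

contiguous-uncons : ∀ {A : Set} {u w x : A} {xs} → u ≢ x →
  Infix _≡_ (u ∷ w ∷ []) (x ∷ xs) → Infix _≡_ (u ∷ w ∷ []) xs
contiguous-uncons u≢x (here (u≡x ∷ _)) = contradiction u≡x u≢x
contiguous-uncons u≢x (there c)        = c

contiguous-second : ∀ {A : Set} {x w y : A} {ys} → x ∉ y ∷ ys →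
  Infix _≡_ (x ∷ w ∷ []) (x ∷ y ∷ ys) → w ≡ y
contiguous-second x∉ (here (_ ∷ w≡y ∷ [])) = w≡y
contiguous-second x∉ (there c)             = contradiction (proj₁ (contiguous-∈ c)) x∉

contiguous-++⁻ : ∀ {A : Set} {u w : A} xs {y ys} → Infix _≡_ (u ∷ w ∷ []) (xs ++ y ∷ ys) →
  Infix _≡_ (u ∷ w ∷ []) xs ⊎ Infix _≡_ (u ∷ w ∷ []) (y ∷ ys) ⊎ (last xs ≡ just u × w ≡ y)
contiguous-++⁻ []            c = inj₂ (inj₁ c)
contiguous-++⁻ (x ∷ [])      (here (refl ∷ refl ∷ [])) = inj₂ (inj₂ (refl , refl))
contiguous-++⁻ (x ∷ [])      (there c) = inj₂ (inj₁ c)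
contiguous-++⁻ (x ∷ x′ ∷ xs) (here (refl ∷ refl ∷ [])) = inj₁ (here (refl ∷ refl ∷ []))
contiguous-++⁻ (x ∷ x′ ∷ xs) (there c) with contiguous-++⁻ (x′ ∷ xs) c
... | inj₁ c′ = inj₁ (there c′)
... | inj₂ c′ = inj₂ c′

unique-head∉ : ∀ {A : Set} {x : A} {xs} → Unique (x ∷ xs) → x ∉ xs
unique-head∉ (x∉ ∷ _) i = All.lookup x∉ i refl

unique-tail : ∀ {A : Set} {x : A} {xs} → Unique (x ∷ xs) → Unique xs
unique-tail (_ ∷ u) = u

data FirstHit {A : Set} (P : Pred A 0ℓ) : List A → Set where
  firstHit : ∀ xs y ys → All (∁ P) xs → P y → FirstHit P (xs ++ y ∷ ys)

data LastHit {A : Set} (P : Pred A 0ℓ) : List A → Set where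
  lastHit : ∀ xs y ys → P y → All (∁ P) ys → LastHit P (xs ++ y ∷ ys)

module _ {A : Set} {P : Pred A 0ℓ} (P? : Decidable P) where

  firstHit? : ∀ xs → All (∁ P) xs ⊎ FirstHit P xs
  firstHit? [] = inj₁ []
  firstHit? (x ∷ xs) with P? x
  ... | yes px = inj₂ (firstHit [] x xs [] px)
  ... | no ¬px with firstHit? xs
  ...   | inj₁ none                     = inj₁ (¬px ∷ none)
  ...   | inj₂ (firstHit us y ys nu py) = inj₂ (firstHit (x ∷ us) y ys (¬px ∷ nu) py)

  lastHit? : ∀ xs → All (∁ P) xs ⊎ LastHit P xs
  lastHit? [] = inj₁ []
  lastHit? (x ∷ xs) with lastHit? xs
  ... | inj₂ (lastHit us y ys py ny) = inj₂ (lastHit (x ∷ us) y ys py ny)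
  ... | inj₁ none with P? x
  ...   | yes px = inj₂ (lastHit [] x xs px none)
  ...   | no ¬px = inj₁ (¬px ∷ none)

-- Only the outermost hits are recorded, since they bound the two end pieces of `P` that enter
-- holes; `far` assumes nothing about the stretch between them. `two` stands apart because
-- consecutive neighbours of `x` form a triangle with it.
data Hits {A : Set} (P : Pred A 0ℓ) (zs : List A) : Set where
  none : All (∁ P) zs → Hits P zs
  one  : ∀ U u W → zs ≡ U ++ u ∷ W → All (∁ P) U → P u → All (∁ P) W → Hits P zs
  two  : ∀ U u w W → zs ≡ U ++ u ∷ w ∷ W → All (∁ P) U → P u → P w → All (∁ P) W → Hits P zs
  far  : ∀ U u m M w W → zs ≡ U ++ u ∷ m ∷ M ++ w ∷ W →
         All (∁ P) U → P u → P w → All (∁ P) W → Hits P zs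

hits : ∀ {A : Set} {P : Pred A 0ℓ} → Decidable P → ∀ zs → Hits P zs
hits P? zs with lastHit? P? zs
... | inj₁ np = none np
... | inj₂ (lastHit xs w W pw nW) with firstHit? P? xs
...   | inj₁ nxs                           = one xs w W refl nxs pw nW
...   | inj₂ (firstHit U u [] nU pu)       = two U u w W (++-assoc U (u ∷ []) (w ∷ W)) nU pu pw nW
...   | inj₂ (firstHit U u (m ∷ M) nU pu)  = far U u m M w W (++-assoc U (u ∷ m ∷ M) (w ∷ W)) nU pu pw nW

data Closest {A : Set} (P Q : Pred A 0ℓ) (zs : List A) : Set where
  closest : ∀ X x M y Y → zs ≡ X ++ x ∷ M ++ y ∷ Y → All (∁ P) M → All (∁ Q) M →
            P x × Q y ⊎ Q x × P y → Closest P Q zs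

closest-∷ : ∀ {A : Set} {P Q : Pred A 0ℓ} z {zs} → Closest P Q zs → Closest P Q (z ∷ zs)
closest-∷ z (closest X x M y Y e nP nQ ends) = closest (z ∷ X) x M y Y (cong (z ∷_) e) nP nQ ends

nearest : ∀ {A : Set} {P Q : Pred A 0ℓ} → Decidable Q → ∀ z zs →
  P z → ¬ Any P zs → Any Q zs → Closest P Q (z ∷ zs)
nearest Q? z zs pz noP hq with firstHit? Q? zs
... | inj₁ nQ                   = contradiction hq (All¬⇒¬Any nQ)
... | inj₂ (firstHit M y Y nQ qy) =
  closest [] z M y Y refl (++⁻ˡ M (¬Any⇒All¬ _ noP)) nQ (inj₁ (pz , qy))

closest-swap : ∀ {A : Set} {P Q : Pred A 0ℓ} {zs} → Closest P Q zs → Closest Q P zs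
closest-swap (closest X x M y Y e nP nQ ends) = closest X x M y Y e nQ nP (swap ends)

closestPair : ∀ {A : Set} {P Q : Pred A 0ℓ} → Decidable P → Decidable Q →
  ∀ zs → Any P zs → Any Q zs → (∀ {z} → z ∈ zs → P z → ¬ Q z) → Closest P Q zs
closestPair P? Q? (z ∷ zs) hp hq excl with any? P? zs | any? Q? zs | hp | hq
... | yes hp′ | yes hq′ | _        | _        = closest-∷ z (closestPair P? Q? zs hp′ hq′ (excl ∘ there))
... | _       | no noQ  | _        | there h  = contradiction h noQ
... | no noP  | _       | there h  | _        = contradiction h noP
... | _       | no noQ  | here pz  | here qz  = contradiction qz (excl (here refl) pz)
... | no noP  | _       | here pz  | here qz  = contradiction qz (excl (here refl) pz)
... | no noP  | yes _   | here pz  | there h  = nearest Q? z zs pz noP h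
... | yes _   | no noQ  | there h  | here qz  = closest-swap (nearest P? z zs qz noQ h)

module _ {A : Set} {P : Pred A 0ℓ} {x y : A} {M : List A} (noM : All (∁ P) M) where

  only-last : ¬ P x → ∀ {z} → z ∈ x ∷ M ∷ʳ y → P z → z ≡ y
  only-last ¬px (here refl) pz = contradiction pz ¬px
  only-last ¬px (there i)   pz with ∈-∷ʳ⁻ M i
  ... | inj₁ j = contradiction pz (All.lookup noM j)
  ... | inj₂ p = p

  only-first : ¬ P y → ∀ {z} → z ∈ x ∷ M ∷ʳ y → P z → z ≡ x
  only-first ¬py (here p)  pz = p
  only-first ¬py (there i) pz with ∈-∷ʳ⁻ M i
  ... | inj₁ j    = contradiction pz (All.lookup noM j)
  ... | inj₂ refl = contradiction pz ¬py

-- Three applications extract the vertices of a triangle from a clique of size above 2.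
pick : ∀ {n m} (K : Subset n) → suc m ≤ ∣ K ∣ →
  ∃[ x ] x ∈ˢ K × ∃[ K′ ] K′ ⊆ˢ K × ¬ x ∈ˢ K′ × m ≤ ∣ K′ ∣
pick (outside ∷ K) m< with pick K m<
... | x , x∈ , K′ , K′⊆ , x∉ , m≤ =
  suc x , there x∈ , outside ∷ K′ , (λ { (there i) → there (K′⊆ i) }) , (λ { (there i) → x∉ i }) , m≤
pick (inside ∷ K) (s≤s m≤) = zero , here , outside ∷ K , (λ { (there i) → there i }) , (λ ()) , m≤

-- Induced paths, and the 2-colouring of a triangle-free induced subgraph

module Paths {n : ℕ} (G : Graph n) where
  open Graph G

  V : Set
  V = Fin n

  infix 4 _∥_
  _∥_ : V → V → Set
  x ∥ y = x ≢ y × ¬ x ~ y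

  -- Inducedness sits in each step: the head sees its successor and is anticomplete to everything
  -- beyond it. Adjacency on a path is then decided by recursion, without positions in a list.
  data Path : V → V → List V → Set where
    [-]  : ∀ {x} → Path x x (x ∷ [])
    step : ∀ {x y z ys} → x ~ y → All (x ∥_) ys → Path y z (y ∷ ys) → Path x z (x ∷ y ∷ ys)

  ~⇒≢ : ∀ {x y} → x ~ y → x ≢ y
  ~⇒≢ e refl = ~-irrefl refl e

  path-head : ∀ {x y X} → Path x y X → ∃[ xs ] X ≡ x ∷ xs
  path-head [-]          = _ , refl
  path-head (step _ _ _) = _ , refl

  first∈ : ∀ {x y X} → Path x y X → x ∈ X
  first∈ [-]          = here refl
  first∈ (step _ _ _) = here refl

  last∈ : ∀ {x y X} → Path x y X → y ∈ X
  last∈ [-]          = here refl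
  last∈ (step _ _ π) = there (last∈ π)

  path-∷ : ∀ {x y z Y} → x ~ y → Path y z Y → x ∉ Y → (∀ {w} → w ∈ Y → x ~ w → w ≡ y) → Path x z (x ∷ Y)
  path-∷ e [-] x∉ only = step e [] [-]
  path-∷ {x} e π@(step {ys = ys} f ns _) x∉ only = step e (All.tabulate apart′) π
    where
    apart′ : ∀ {w} → w ∈ _ ∷ ys → x ∥ w
    apart′ i = (λ { refl → x∉ (there i) }) , λ e′ → case-only i (only (there i) e′)
      where
      case-only : ∀ {w} → w ∈ _ ∷ ys → w ≢ _
      case-only (here refl) refl = ~-irrefl refl f
      case-only (there j)   refl = proj₁ (All.lookup ns j) refl

  path-++ : ∀ {x y x′ y′ X Y} → Path x y X → Path x′ y′ Y → y ~ x′ → Disjoint X Y →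
    (∀ {u w} → u ∈ X → w ∈ Y → u ~ w → u ≡ y × w ≡ x′) → Path x y′ (X ++ Y)
  path-++ [-] ρ e dis adj = path-∷ e ρ (λ i → dis (here refl , i)) (λ i → proj₂ ∘ adj (here refl) i)
  path-++ {X = x ∷ z ∷ zs} {Y} (step f ns π) ρ e dis adj =
    step f (++⁺ ns (All.tabulate λ i → (λ { refl → dis (here refl , i) }) ,
                                       λ e′ → x≢y (proj₁ (adj (here refl) i e′))))
      (path-++ π ρ e (λ (i , j) → dis (there i , j)) (adj ∘ there))
    where
    x≢y : x ≢ _
    x≢y refl with last∈ π
    ... | here refl = ~-irrefl refl f
    ... | there i   = proj₁ (All.lookup ns i) refl

  head∉ : ∀ {x y xs} → Path x y (x ∷ xs) → x ∉ xs
  head∉ (step f ns π) (here refl) = ~-irrefl refl f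
  head∉ (step f ns π) (there i)   = proj₁ (All.lookup ns i) refl

  nbr-head : ∀ {x y z ys w} → Path x z (x ∷ y ∷ ys) → w ∈ x ∷ y ∷ ys → x ~ w → w ≡ y
  nbr-head π             (here refl)         e = contradiction e (~-irrefl refl)
  nbr-head π             (there (here refl)) e = refl
  nbr-head (step _ ns _) (there (there i))   e = contradiction e (proj₂ (All.lookup ns i))

  path-∷ʳ : ∀ {x y z X} → Path x y X → y ~ z → z ∉ X → (∀ {u} → u ∈ X → u ~ z → u ≡ y) → Path x z (X ∷ʳ z)
  path-∷ʳ π e z∉ only = path-++ π [-] e (λ { (i , here refl) → z∉ i }) (λ { i (here refl) f → only i f , refl })

  path-reverse : ∀ {x y X} → Path x y X → Path y x (reverse X)
  path-reverse [-] = [-]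
  path-reverse {x} {y} (step {y = z} {ys = ys} e ns π) =
    subst (Path y x) (sym (unfold-reverse x (z ∷ ys)))
      (path-∷ʳ (path-reverse π) (~-sym e) (head∉ (step e ns π) ∘ reverse⁻)
        (λ i f → nbr-head (step e ns π) (there (reverse⁻ i)) (~-sym f)))

  splitˡ : ∀ {x z} X {w Y} → Path x z (X ++ w ∷ Y) → Path x w (X ∷ʳ w)
  splitˡ []          π             with path-head π
  ... | _ , refl = [-]
  splitˡ (u ∷ [])    (step e ns π) = step e [] [-]
  splitˡ (u ∷ y ∷ X) (step e ns π) = step e (++⁺ (++⁻ˡ X ns) (All.head (++⁻ʳ X ns) ∷ [])) (splitˡ (y ∷ X) π)

  splitʳ : ∀ {x z} X {w Y} → Path x z (X ++ w ∷ Y) → Path w z (w ∷ Y)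
  splitʳ []          π             with path-head π
  ... | _ , refl = π
  splitʳ (u ∷ [])    (step e ns π) = π
  splitʳ (u ∷ y ∷ X) (step e ns π) = splitʳ (y ∷ X) π

  apart : ∀ {x z} X {w Y s t} → Path x z (X ++ w ∷ Y) → s ∈ X → t ∈ Y → s ∥ t
  apart (u ∷ [])    (step e ns π) (here refl) j = All.lookup ns j
  apart (u ∷ y ∷ X) (step e ns π) (here refl) j = All.lookup ns (∈-++⁺ʳ X (there j))
  apart (u ∷ y ∷ X) (step e ns π) (there i)   j = apart (y ∷ X) π i j

  module _ {x z} U {u w W} (π : Path x z (U ++ u ∷ w ∷ W)) where

    cut-edge : u ~ w
    cut-edge with step e _ _ ← splitʳ U π = e

    cut-~ : ∀ {s t} → s ∈ U ∷ʳ u → t ∈ w ∷ W → s ~ t → s ≡ u × t ≡ w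
    cut-~ i j e with ∈-∷ʳ⁻ U i
    ... | inj₁ i′   = contradiction e (proj₂ (apart U π i′ j))
    ... | inj₂ refl = refl , nbr-head (splitʳ U π) (there j) e

    cut-disjoint : Disjoint (U ∷ʳ u) (w ∷ W)
    cut-disjoint (i , j) with ∈-∷ʳ⁻ U i
    ... | inj₁ i′   = proj₁ (apart U π i′ j) refl
    ... | inj₂ refl = head∉ (splitʳ U π) j

    last∉ : z ∉ U ∷ʳ u
    last∉ i with step _ _ ρ ← splitʳ U π = cut-disjoint (i , last∈ ρ)

    last-cut : Path w z (w ∷ W)
    last-cut with step _ _ ρ ← splitʳ U π = ρ

  far-∥ : ∀ {x z} U {u m M w W s t} → Path x z (U ++ u ∷ m ∷ M ++ w ∷ W) →
    s ∈ U ∷ʳ u → t ∈ w ∷ W → s ∥ t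
  far-∥ U {M = M} π i j with ∈-∷ʳ⁻ U i
  ... | inj₁ i′   = apart U π i′ (there (∈-++⁺ʳ M j))
  ... | inj₂ refl with step _ ns _ ← splitʳ U π = All.lookup ns (∈-++⁺ʳ M j)

  infix-path : ∀ {x z} X {s M t Y} → Path x z (X ++ s ∷ M ++ t ∷ Y) → Path s t (s ∷ M ∷ʳ t)
  infix-path X {s} {M} π = splitˡ (s ∷ M) (splitʳ X π)

  -- The half turn exchanges the ends of a connecting path but not the list of its vertices, so the
  -- direction of listing is left open.
  Route : V → V → List V → Set
  Route x y X = Path x y X ⊎ Path y x X

  routeEnds : ∀ {x y X} → Route x y X → x ∈ X × y ∈ X
  routeEnds (inj₁ π) = first∈ π , last∈ π
  routeEnds (inj₂ π) = last∈ π , first∈ π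

  path-unique : ∀ {x y X} → Path x y X → Unique X
  path-unique [-] = [] ∷ []
  path-unique π@(step e ns ρ) = All.tabulate (λ { i refl → head∉ π i }) ∷ path-unique ρ

  consecutive-~ : ∀ {x y X u w} → Path x y X → Contiguous (u ∷ w ∷ []) X → u ~ w
  consecutive-~ [-] (here (_ ∷ ()))
  consecutive-~ [-] (there (here ()))
  consecutive-~ (step e _ _) (here (refl ∷ refl ∷ [])) = e
  consecutive-~ (step _ _ π) (there c)                 = consecutive-~ π c

  ~-consecutive : ∀ {x y X u w} → Path x y X → u ∈ X → w ∈ X → u ~ w →
    Contiguous (u ∷ w ∷ []) X ⊎ Contiguous (w ∷ u ∷ []) X
  ~-consecutive [-] (here refl) (here refl) e = contradiction e (~-irrefl refl)
  ~-consecutive π@(step _ _ _) (here refl) j e with refl ← nbr-head π j e = inj₁ (here (refl ∷ refl ∷ []))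
  ~-consecutive π@(step _ _ _) i (here refl) e with refl ← nbr-head π i (~-sym e) = inj₂ (here (refl ∷ refl ∷ []))
  ~-consecutive (step _ _ π) (there i) (there j) e with ~-consecutive π i j e
  ... | inj₁ c = inj₁ (there c)
  ... | inj₂ c = inj₂ (there c)

  path-last : ∀ {x y X} → Path x y X → last X ≡ just y
  path-last [-]          = refl
  path-last (step _ _ π) = path-last π

  toIsPath : ∀ {x y X} → Path x y X → IsPath G x y X
  toIsPath π = record
    { starts  = cong head (proj₂ (path-head π))
    ; ends    = path-last π
    ; unique  = path-unique π
    ; induced = λ i j → mk⇔ (~-consecutive π i j) [ consecutive-~ π , ~-sym ∘ consecutive-~ π ]′
    }

  module _ {x y h z zs} (π : IsPath G x y (h ∷ z ∷ zs)) where
    open IsPath π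

    isPath-tail : IsPath G z y (z ∷ zs)
    isPath-tail = record
      { starts  = refl ; ends = ends ; unique = unique-tail unique
      ; induced = λ i j → mk⇔
          (λ e → [ inj₁ ∘ contiguous-uncons (≢h i) , inj₂ ∘ contiguous-uncons (≢h j) ]′ (Equivalence.to (induced (there i) (there j)) e))
          (λ c → Equivalence.from (induced (there i) (there j)) ([ inj₁ ∘ there , inj₂ ∘ there ]′ c)) }
      where
      ≢h : ∀ {w} → w ∈ z ∷ zs → w ≢ h
      ≢h i refl = unique-head∉ unique i

    isPath-step : Path z y (z ∷ zs) → Path x y (h ∷ z ∷ zs)
    isPath-step ρ with refl ← starts =
      step (Equivalence.from (induced (here refl) (there (here refl))) (inj₁ (here (refl ∷ refl ∷ []))))
        (All.tabulate λ i → (λ { refl → unique-head∉ unique (there i) })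
                          , λ e → nonconsecutive i (Equivalence.to (induced (here refl) (there (there i))) e))
        ρ
      where
      nonconsecutive : ∀ {w} → w ∈ zs → ¬ (Contiguous (h ∷ w ∷ []) (h ∷ z ∷ zs) ⊎ Contiguous (w ∷ h ∷ []) (h ∷ z ∷ zs))
      nonconsecutive i (inj₁ (here (_ ∷ refl ∷ []))) = unique-head∉ (unique-tail unique) i
      nonconsecutive i (inj₁ (there c))              = unique-head∉ unique (proj₁ (contiguous-∈ c))
      nonconsecutive i (inj₂ (here (refl ∷ _)))      = unique-head∉ unique (there i)
      nonconsecutive i (inj₂ (there c))              = unique-head∉ unique (proj₂ (contiguous-∈ c))

  fromIsPath : ∀ {x y X} → IsPath G x y X → Path x y X
  fromIsPath {X = []}         π with () ← IsPath.starts π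
  fromIsPath {X = x ∷ []}     π with refl ← IsPath.starts π | refl ← IsPath.ends π = [-]
  fromIsPath {X = x ∷ z ∷ zs} π = isPath-step π (fromIsPath (isPath-tail π))

  TriangleFree : List V → Set
  TriangleFree S = ∀ {x y z} → x ∈ S → y ∈ S → z ∈ S → x ~ y → y ~ z → x ~ z → ⊥

  path-triangleFree : ∀ {x y X} → Path x y X → TriangleFree X
  path-triangleFree [-] (here refl) (here refl) _ e _ _ = ~-irrefl refl e
  path-triangleFree π@(step _ _ _) (here refl) j k e f g
    with refl ← nbr-head π j e | refl ← nbr-head π k g = ~-irrefl refl f
  path-triangleFree π@(step _ _ _) i (here refl) k e f g
    with refl ← nbr-head π i (~-sym e) | refl ← nbr-head π k f = ~-irrefl refl g
  path-triangleFree π@(step _ _ _) i j (here refl) e f g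
    with refl ← nbr-head π i (~-sym g) | refl ← nbr-head π j (~-sym f) = ~-irrefl refl e
  path-triangleFree (step _ _ π) (there i) (there j) (there k) = path-triangleFree π i j k

  route-triangleFree : ∀ {x y X} → Route x y X → TriangleFree X
  route-triangleFree = [ path-triangleFree , path-triangleFree ]′

  -- This only limits the edges between `X` and `Y`; that the two edges are present is required
  -- separately. The same condition serves two paths closing up to a hole and two of the paths of a
  -- prism.
  Joins : V → V → V → V → List V → List V → Set
  Joins x y x′ y′ X Y = ∀ {u w} → u ∈ X → w ∈ Y → u ~ w → (u ≡ x × w ≡ x′) ⊎ (u ≡ y × w ≡ y′)

  joins-flip : ∀ {x y x′ y′ X Y} → Joins x y x′ y′ X Y → Joins x′ y′ x y Y X
  joins-flip J i j e with J j i (~-sym e)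
  ... | inj₁ (p , q) = inj₁ (q , p)
  ... | inj₂ (p , q) = inj₂ (q , p)

  joined-no-triangle : ∀ {x y x′ y′ X Y} → Joins x y x′ y′ X Y → (x′ ≡ y′ → ¬ x ~ y) →
    ∀ {s t u} → s ∈ X → t ∈ X → u ∈ Y → s ~ t → s ~ u → ¬ t ~ u
  joined-no-triangle J nd i j k e f g with J i k f | J j k g
  ... | inj₁ (refl , _)    | inj₁ (refl , _)    = ~-irrefl refl e
  ... | inj₂ (refl , _)    | inj₂ (refl , _)    = ~-irrefl refl e
  ... | inj₁ (refl , refl) | inj₂ (refl , refl) = nd refl e
  ... | inj₂ (refl , refl) | inj₁ (refl , refl) = nd refl (~-sym e)

  -- A triangle meeting both paths uses both connecting edges at one vertex. So one path has
  -- coinciding ends while the ends of the other are adjacent, which the last two conditions forbid.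
  joined-triangleFree : ∀ {x y x′ y′ X Y} → Route x y X → Route x′ y′ Y → Joins x y x′ y′ X Y →
    (x ≡ y → ¬ x′ ~ y′) → (x′ ≡ y′ → ¬ x ~ y) → TriangleFree (X ++ Y)
  joined-triangleFree {X = X} ρ σ J nd nd′ i j k e f g with ∈-++⁻ X i | ∈-++⁻ X j | ∈-++⁻ X k
  ... | inj₁ i′ | inj₁ j′ | inj₁ k′ = route-triangleFree ρ i′ j′ k′ e f g
  ... | inj₂ i′ | inj₂ j′ | inj₂ k′ = route-triangleFree σ i′ j′ k′ e f g
  ... | inj₁ i′ | inj₁ j′ | inj₂ k′ = joined-no-triangle J nd′ i′ j′ k′ e g f
  ... | inj₁ i′ | inj₂ j′ | inj₁ k′ = joined-no-triangle J nd′ i′ k′ j′ g e (~-sym f)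
  ... | inj₂ i′ | inj₁ j′ | inj₁ k′ = joined-no-triangle J nd′ j′ k′ i′ f (~-sym e) (~-sym g)
  ... | inj₂ i′ | inj₂ j′ | inj₁ k′ = joined-no-triangle (joins-flip J) nd i′ j′ k′ e g f
  ... | inj₂ i′ | inj₁ j′ | inj₂ k′ = joined-no-triangle (joins-flip J) nd i′ k′ j′ g e (~-sym f)
  ... | inj₁ i′ | inj₂ j′ | inj₂ k′ = joined-no-triangle (joins-flip J) nd j′ k′ i′ f (~-sym e) (~-sym g)

  fromList : List V → Subset n
  fromList []       = ∅ˢ
  fromList (x ∷ xs) = ⁅ x ⁆ ∪ˢ fromList xs

  fromList⁺ : ∀ {x} xs → x ∈ xs → x ∈ˢ fromList xs
  fromList⁺ (x ∷ xs) (here refl) = x∈p∪q⁺ (inj₁ (x∈⁅x⁆ x))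
  fromList⁺ (x ∷ xs) (there i)   = x∈p∪q⁺ (inj₂ (fromList⁺ xs i))

  fromList⁻ : ∀ {x} xs → x ∈ˢ fromList xs → x ∈ xs
  fromList⁻ []       i = contradiction i ∉⊥
  fromList⁻ (x ∷ xs) i with x∈p∪q⁻ ⁅ x ⁆ (fromList xs) i
  ... | inj₁ j = here (x∈⁅y⁆⇒x≡y x j)
  ... | inj₂ j = there (fromList⁻ xs j)

  -- Three vertices of a clique in `S` would form a triangle, so the clique number, and with it the
  -- chromatic number, is at most 2. A colour below 2 is determined by whether it is 0.
  twoColouring : Perfect G → ∀ S → TriangleFree S →
    Σ[ f ∈ (V → Bool) ] (∀ {x y} → x ∈ S → y ∈ S → x ~ y → f y ≡ not (f x))
  twoColouring perfect S tf with perfect (fromList S)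
  ... | k , ((f , f<k , f≢) , _) , ((K , K⊆S , clique , ∣K∣≡k) , _) =
    isZero ∘ f , λ i j e → isZero-flip (bound i) (bound j) (f≢ (fromList⁺ S i) (fromList⁺ S j) e)
    where
    isZero : ℕ → Bool
    isZero zero    = true
    isZero (suc _) = false

    isZero-flip : ∀ {i j} → i < 2 → j < 2 → i ≢ j → isZero j ≡ not (isZero i)
    isZero-flip {zero}        {zero}        _ _ i≢j = contradiction refl i≢j
    isZero-flip {zero}        {suc _}       _ _ _   = refl
    isZero-flip {suc _}       {zero}        _ _ _   = refl
    isZero-flip {suc zero}    {suc zero}    _ _ i≢j = contradiction refl i≢j
    isZero-flip {suc (suc _)} (s≤s (s≤s ()))
    isZero-flip {suc zero}    {suc (suc _)} _ (s≤s (s≤s ()))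

    k≤2 : k ≤ 2
    k≤2 with k ≤? 2
    ... | yes k≤2 = k≤2
    ... | no  k≰2 with pick K (subst (3 ≤_) (sym ∣K∣≡k) (≰⇒> k≰2))
    ...   | x , x∈ , K₁ , K₁⊆ , x∉ , 2≤ with pick K₁ 2≤
    ...     | y , y∈ , K₂ , K₂⊆ , y∉ , 1≤ with pick K₂ 1≤
    ...       | z , z∈ , _ =
      ⊥-elim (tf (inS x∈) (inS y∈′) (inS z∈″)
        (clique x∈ y∈′ (λ { refl → x∉ y∈ }))
        (clique y∈′ z∈″ (λ { refl → y∉ z∈ }))
        (clique x∈ z∈″ (λ { refl → x∉ (K₂⊆ z∈) })))
      where
      y∈′ = K₁⊆ y∈
      z∈″ = K₁⊆ (K₂⊆ z∈)
      inS : ∀ {u} → u ∈ˢ K → u ∈ S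
      inS = fromList⁻ S ∘ K⊆S

    bound : ∀ {x} → x ∈ S → f x < 2
    bound i = <-≤-trans (f<k (fromList⁺ S i)) k≤2

  -- Colours alternate along the path, so its ends agree in colour exactly when it has an odd number
  -- of vertices.
  path-colour : ∀ {S} (f : V → Bool) → (∀ {x y} → x ∈ S → y ∈ S → x ~ y → f y ≡ not (f x)) →
    ∀ {x y X} → Path x y X → (∀ {u} → u ∈ X → u ∈ S) → odd X ≡ not (f x xor f y)
  path-colour f alt {x} [-] X⊆S with f x
  ... | true  = refl
  ... | false = refl
  path-colour f alt {x} {z} (step {y = y} e _ π) X⊆S
    rewrite path-colour f alt π (X⊆S ∘ there) | alt (X⊆S (here refl)) (X⊆S (there (here refl))) e
    with f x | f z
  ... | true  | true  = refl
  ... | true  | false = refl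
  ... | false | true  = refl
  ... | false | false = refl

  route-colour : ∀ {S} (f : V → Bool) → (∀ {x y} → x ∈ S → y ∈ S → x ~ y → f y ≡ not (f x)) →
    ∀ {x y X} → Route x y X → (∀ {u} → u ∈ X → u ∈ S) → odd X ≡ not (f x xor f y)
  route-colour f alt (inj₁ π) X⊆S = path-colour f alt π X⊆S
  route-colour f alt {x} {y} (inj₂ π) X⊆S = trans (path-colour f alt π X⊆S) (cong not (xor-comm (f y) (f x)))

  -- X and Y close up to a hole, whose length is even; no list of its vertices in
  -- cyclic order is needed.
  equalParity : Perfect G → ∀ {x y x′ y′ X Y} → Route x y X → Route x′ y′ Y →
    x ~ x′ → y ~ y′ → Joins x y x′ y′ X Y → (x ≡ y → ¬ x′ ~ y′) → (x′ ≡ y′ → ¬ x ~ y) →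
    odd X ≡ odd Y
  equalParity perfect {x} {y} {x′} {y′} {X} {Y} ρ σ e e′ J nd nd′
    with twoColouring perfect (X ++ Y) (joined-triangleFree ρ σ J nd nd′)
  ... | f , alt = trans (route-colour f alt ρ ∈-++⁺ˡ) (trans (flipped (f x) (f y) (f x′) (f y′)
        (alt (∈-++⁺ˡ (proj₁ (routeEnds ρ))) (∈-++⁺ʳ X (proj₁ (routeEnds σ))) e)
        (alt (∈-++⁺ˡ (proj₂ (routeEnds ρ))) (∈-++⁺ʳ X (proj₂ (routeEnds σ))) e′))
        (sym (route-colour f alt σ (∈-++⁺ʳ X))))
    where
    flipped : ∀ a b a′ b′ → a′ ≡ not a → b′ ≡ not b → not (a xor b) ≡ not (a′ xor b′)
    flipped true  true  _ _ refl refl = refl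
    flipped true  false _ _ refl refl = refl
    flipped false true  _ _ refl refl = refl
    flipped false false _ _ refl refl = refl

  -- Prisms and 4-cycles built from their paths and edges

  orient : ∀ {x y X} → Route x y X → ∃[ Y ] Path x y Y × (∀ {u} → u ∈ Y → u ∈ X)
  orient (inj₁ π) = _ , π , id
  orient (inj₂ π) = _ , path-reverse π , reverse⁻

  prism : ∀ {a₁ a₂ a₃ b₁ b₂ b₃ P₁ P₂ P₃} →
    Route a₁ b₁ P₁ → Route a₂ b₂ P₂ → Route a₃ b₃ P₃ →
    a₁ ~ a₂ → a₁ ~ a₃ → a₂ ~ a₃ → b₁ ~ b₂ → b₁ ~ b₃ → b₂ ~ b₃ →
    a₁ ≢ b₁ → a₂ ≢ b₂ → a₃ ≢ b₃ →
    Disjoint P₁ P₂ → Disjoint P₁ P₃ → Disjoint P₂ P₃ →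
    Joins a₁ b₁ a₂ b₂ P₁ P₂ → Joins a₁ b₁ a₃ b₃ P₁ P₃ → Joins a₂ b₂ a₃ b₃ P₂ P₃ → Prism G
  prism {a₁} {a₂} {a₃} {b₁} {b₂} {b₃} ρ₁ ρ₂ ρ₃ a₁₂ a₁₃ a₂₃ b₁₂ b₁₃ b₂₃ a≢b₁ a≢b₂ a≢b₃ d₁₂ d₁₃ d₂₃ J₁₂ J₁₃ J₂₃
    with orient ρ₁ | orient ρ₂ | orient ρ₃
  ... | X₁ , π₁ , s₁ | X₂ , π₂ , s₂ | X₃ , π₃ , s₃ = record
    { a = pick₃ a₁ a₂ a₃
    ; b = pick₃ b₁ b₂ b₃
    ; P = pick₃ X₁ X₂ X₃
    ; triangleᵃ = triangle a₁₂ a₁₃ a₂₃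
    ; triangleᵇ = triangle b₁₂ b₁₃ b₂₃
    ; a≢b = ends
    ; path = λ { zero → toIsPath π₁ ; (suc zero) → toIsPath π₂ ; (suc (suc zero)) → toIsPath π₃ }
    ; disjoint = λ
      { {zero} {suc zero}             _ (i , j) → d₁₂ (s₁ i , s₂ j)
      ; {zero} {suc (suc zero)}       _ (i , j) → d₁₃ (s₁ i , s₃ j)
      ; {suc zero} {suc (suc zero)}   _ (i , j) → d₂₃ (s₂ i , s₃ j)
      ; {suc zero} {suc zero} (s≤s ())
      ; {suc (suc zero)} {suc zero} (s≤s ())
      ; {suc (suc zero)} {suc (suc zero)} (s≤s (s≤s ()))
      }
    ; onlyEdges = λ
      { {zero} {suc zero}             _ i j → J₁₂ (s₁ i) (s₂ j)
      ; {zero} {suc (suc zero)}       _ i j → J₁₃ (s₁ i) (s₃ j)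
      ; {suc zero} {suc (suc zero)}   _ i j → J₂₃ (s₂ i) (s₃ j)
      ; {suc zero} {suc zero} (s≤s ())
      ; {suc (suc zero)} {suc zero} (s≤s ())
      ; {suc (suc zero)} {suc (suc zero)} (s≤s (s≤s ()))
      }
    }
    where
    pick₃ : ∀ {A : Set} → A → A → A → Fin 3 → A
    pick₃ x y z zero             = x
    pick₃ x y z (suc zero)       = y
    pick₃ x y z (suc (suc zero)) = z

    triangle : ∀ {x y z} → x ~ y → x ~ z → y ~ z → ∀ {i j} → i ≢ j → pick₃ x y z i ~ pick₃ x y z j
    triangle xy xz yz {zero}           {zero}           i≢j = contradiction refl i≢j
    triangle xy xz yz {zero}           {suc zero}       _   = xy
    triangle xy xz yz {zero}           {suc (suc zero)} _   = xz
    triangle xy xz yz {suc zero}       {zero}           _   = ~-sym xy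
    triangle xy xz yz {suc zero}       {suc zero}       i≢j = contradiction refl i≢j
    triangle xy xz yz {suc zero}       {suc (suc zero)} _   = yz
    triangle xy xz yz {suc (suc zero)} {zero}           _   = ~-sym xz
    triangle xy xz yz {suc (suc zero)} {suc zero}       _   = ~-sym yz
    triangle xy xz yz {suc (suc zero)} {suc (suc zero)} i≢j = contradiction refl i≢j

    apart₃ : ∀ {x y x′ y′ X Y} → Route x y X → Route x′ y′ Y → Disjoint X Y → x ≢ y′
    apart₃ ρ σ d refl = d (proj₁ (routeEnds ρ) , proj₂ (routeEnds σ))

    flipᵈ : ∀ {X Y : List V} → Disjoint X Y → Disjoint Y X
    flipᵈ d (i , j) = d (j , i)

    ends : ∀ i j → pick₃ a₁ a₂ a₃ i ≢ pick₃ b₁ b₂ b₃ j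
    ends zero             zero             = a≢b₁
    ends zero             (suc zero)       = apart₃ ρ₁ ρ₂ d₁₂
    ends zero             (suc (suc zero)) = apart₃ ρ₁ ρ₃ d₁₃
    ends (suc zero)       zero             = apart₃ ρ₂ ρ₁ (flipᵈ d₁₂)
    ends (suc zero)       (suc zero)       = a≢b₂
    ends (suc zero)       (suc (suc zero)) = apart₃ ρ₂ ρ₃ d₂₃
    ends (suc (suc zero)) zero             = apart₃ ρ₃ ρ₁ (flipᵈ d₁₃)
    ends (suc (suc zero)) (suc zero)       = apart₃ ρ₃ ρ₂ (flipᵈ d₂₃)
    ends (suc (suc zero)) (suc (suc zero)) = a≢b₃

  no-4-cycle : C₄-free G → ∀ {w x y z} → w ~ x → x ~ y → y ~ z → z ~ w → w ∥ y → x ∥ z → ⊥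
  no-4-cycle c₄ {w} {x} {y} {z} wx xy yz zw (w≢y , w≁y) (x≢z , x≁z) =
    c₄ (w ∷ x ∷ y ∷ z ∷ []) (record { long = ≤-refl ; unique = uniq ; induced = λ i j → mk⇔ (cyc i j) [ adj , ~-sym ∘ adj ]′ }) refl
    where
    H = w ∷ x ∷ y ∷ z ∷ []
    pattern 0th = here refl
    pattern 1st = there (here refl)
    pattern 2nd = there (there (here refl))
    pattern 3rd = there (there (there (here refl)))
    pattern pair = here (refl ∷ refl ∷ [])

    uniq : Unique H
    uniq = (~⇒≢ wx ∷ w≢y ∷ ~⇒≢ zw ∘ sym ∷ []) ∷ (~⇒≢ xy ∷ x≢z ∷ []) ∷ (~⇒≢ yz ∷ []) ∷ [] ∷ []

    adj : ∀ {s t} → Contiguous (s ∷ t ∷ []) (H ++ H) → s ~ t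
    adj pair = wx
    adj (there pair) = xy
    adj (there (there pair)) = yz
    adj (there (there (there pair))) = zw
    adj (there (there (there (there pair)))) = wx
    adj (there (there (there (there (there pair))))) = xy
    adj (there (there (there (there (there (there pair)))))) = yz
    adj (there (there (there (there (there (there (there (here (_ ∷ ())))))))))
    adj (there (there (there (there (there (there (there (there (here ())))))))))

    cyc : ∀ {s t} → s ∈ H → t ∈ H → s ~ t → Contiguous (s ∷ t ∷ []) (H ++ H) ⊎ Contiguous (t ∷ s ∷ []) (H ++ H)
    cyc 0th 0th e = contradiction e (~-irrefl refl)
    cyc 1st 1st e = contradiction e (~-irrefl refl)
    cyc 2nd 2nd e = contradiction e (~-irrefl refl)
    cyc 3rd 3rd e = contradiction e (~-irrefl refl)
    cyc 0th 2nd e = contradiction e w≁y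
    cyc 2nd 0th e = contradiction (~-sym e) w≁y
    cyc 1st 3rd e = contradiction e x≁z
    cyc 3rd 1st e = contradiction (~-sym e) x≁z
    cyc 0th 1st e = inj₁ pair
    cyc 1st 0th e = inj₂ pair
    cyc 1st 2nd e = inj₁ (there pair)
    cyc 2nd 1st e = inj₂ (there pair)
    cyc 2nd 3rd e = inj₁ (there (there pair))
    cyc 3rd 2nd e = inj₂ (there (there pair))
    cyc 3rd 0th e = inj₁ (there (there (there pair)))
    cyc 0th 3rd e = inj₂ (there (there (there pair)))

-- Line wheels and the paths attaching to them

module LineWheels {n : ℕ} (G : Graph n) (c₄ : C₄-free G) (prismFree : Prism-free G) (perfect : Perfect G) where
  open Graph G
  open Paths G

  -- Q runs from c to b, so that rotating the hole by half a turn exchanges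
  -- (a , P , d) with (c , Q , b).
  record Frame (v a b c d : V) (P Q : List V) : Set where
    field
      pathP   : Path a d P
      pathQ   : Path c b Q
      ab      : a ~ b
      cd      : c ~ d
      va      : v ~ a
      vb      : v ~ b
      vc      : v ~ c
      vd      : v ~ d
      a∥d     : a ∥ d
      c∥b     : c ∥ b
      joinsPQ : Joins a d b c P Q
      P#Q     : Disjoint P Q
      nbrP    : ∀ {u} → u ∈ P → v ~ u → u ≡ a ⊎ u ≡ d
      nbrQ    : ∀ {u} → u ∈ Q → v ~ u → u ≡ c ⊎ u ≡ b
      v∉P     : v ∉ P
      v∉Q     : v ∉ Q

  joins-swap : ∀ {x y x′ y′ X Y} → Joins x y x′ y′ X Y → Joins y x y′ x′ X Y
  joins-swap J i j e = swap (J i j e)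

  rotate : ∀ {v a b c d P Q} → Frame v a b c d P Q → Frame v c d a b Q P
  rotate F = record
    { pathP = pathQ ; pathQ = pathP ; ab = cd ; cd = ab ; va = vc ; vb = vd ; vc = va ; vd = vb
    ; a∥d = c∥b ; c∥b = a∥d ; joinsPQ = joins-swap (joins-flip joinsPQ)
    ; P#Q = λ (i , j) → P#Q (j , i)
    ; nbrP = nbrQ ; nbrQ = nbrP ; v∉P = v∉Q ; v∉Q = v∉P }
    where open Frame F

  reflect : ∀ {v a b c d P Q} → Frame v a b c d P Q → Frame v d c b a (reverse P) (reverse Q)
  reflect F = record
    { pathP = path-reverse pathP ; pathQ = path-reverse pathQ
    ; ab = ~-sym cd ; cd = ~-sym ab ; va = vd ; vb = vc ; vc = vb ; vd = va
    ; a∥d = ∥-sym a∥d ; c∥b = ∥-sym c∥b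
    ; joinsPQ = λ i j e → swap (joinsPQ (reverse⁻ i) (reverse⁻ j) e)
    ; P#Q = λ (i , j) → P#Q (reverse⁻ i , reverse⁻ j)
    ; nbrP = λ i e → swap (nbrP (reverse⁻ i) e) ; nbrQ = λ i e → swap (nbrQ (reverse⁻ i) e)
    ; v∉P = v∉P ∘ reverse⁻ ; v∉Q = v∉Q ∘ reverse⁻ }
    where
    open Frame F
    ∥-sym : ∀ {x y} → x ∥ y → y ∥ x
    ∥-sym (x≢y , x≁y) = x≢y ∘ sym , x≁y ∘ ~-sym

  -- The reduced form of a counterexample: `R` avoids N[v], and only its ends touch `P` minus `a`
  -- and `Q` minus `c`. How `a` and `c` attach to `R` is left free; the whole argument turns on
  -- that.
  record Link (v a c : V) (P Q : List V) (x y : V) (R : List V) : Set where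
    field
      routeR : Route x y R
      xP     : ∃[ u ] u ∈ P × u ≢ a × x ~ u
      yQ     : ∃[ u ] u ∈ Q × u ≢ c × y ~ u
      nbrPR  : ∀ {z u} → z ∈ R → u ∈ P → u ≢ a → z ~ u → z ≡ x
      nbrQR  : ∀ {z u} → z ∈ R → u ∈ Q → u ≢ c → z ~ u → z ≡ y
      R#P    : Disjoint R P
      R#Q    : Disjoint R Q
      v≁R    : ∀ {z} → z ∈ R → ¬ v ~ z
      v∉R    : v ∉ R

  rotateᴸ : ∀ {v a c P Q x y R} → Link v a c P Q x y R → Link v c a Q P y x R
  rotateᴸ L = record
    { routeR = swap routeR ; xP = yQ ; yQ = xP ; nbrPR = nbrQR ; nbrQR = nbrPR
    ; R#P = R#Q ; R#Q = R#P ; v≁R = v≁R ; v∉R = v∉R }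
    where open Link L

  first∉ : ∀ {x z} X {w Y} → Path x z (X ++ w ∷ Y) → x ∉ Y
  first∉ [] π with path-head π
  ... | _ , refl = head∉ π
  first∉ (u ∷ X) π j with path-head π
  ... | _ , refl = proj₁ (apart (u ∷ X) π (here refl) j) refl

  path-ends : ∀ {x y x′ y′ X} → Path x y X → Path x′ y′ X → x ≡ x′ × y ≡ y′
  path-ends π ρ = just-injective (trans (sym (cong head (proj₂ (path-head π)))) (cong head (proj₂ (path-head ρ))))
                , just-injective (trans (sym (path-last π)) (path-last ρ))

  record FirstNbr (P : List V) (a x u : V) (U : List V) : Set where
    field
      path : Path a u (U ∷ʳ u)
      ⊆P   : ∀ {s} → s ∈ U ∷ʳ u → s ∈ P
      xu   : x ~ u
      only : ∀ {s} → s ∈ U ∷ʳ u → x ~ s → s ≡ u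

  -- A `Link` leaves the neighbours of `a` in `R` free, so the piece has to miss `a`; then only `x`
  -- in `R` has neighbours on it.
  record LastNbr (P : List V) (a d x w : V) (W : List V) : Set where
    field
      path : Path w d (w ∷ W)
      ⊆P   : ∀ {s} → s ∈ w ∷ W → s ∈ P
      a∉   : a ∉ w ∷ W
      xw   : x ~ w
      only : ∀ {s} → s ∈ w ∷ W → x ~ s → s ≡ w

  firstNbr : ∀ {P a d x} U {u U′} → Path a d P → P ≡ U ++ u ∷ U′ → x ~ u → All (λ s → ¬ x ~ s) U →
    FirstNbr P a x u U
  firstNbr {x = x} U {u} π refl e nU = record
    { path = splitˡ U π ; ⊆P = ∷ʳ-⊆ U refl ; xu = e ; only = only }
    where
    only : ∀ {s} → s ∈ U ∷ʳ u → x ~ s → s ≡ u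
    only i f with ∈-∷ʳ⁻ U i
    ... | inj₁ j = contradiction f (All.lookup nU j)
    ... | inj₂ p = p

  lastNbr : ∀ {P a d x} W′ {w W} → Path a d P → P ≡ W′ ++ w ∷ W → w ≢ a → x ~ w → All (λ s → ¬ x ~ s) W →
    LastNbr P a d x w W
  lastNbr W′ π refl w≢a e nW = record
    { path = splitʳ W′ π ; ⊆P = ∈-++⁺ʳ W′
    ; a∉ = λ { (here refl) → w≢a refl ; (there i) → first∉ W′ π i }
    ; xw = e
    ; only = λ { (here refl) _ → refl ; (there i) f → contradiction f (All.lookup nW i) } }

  -- `R` prolonged along `Q` to `b`. Since it avoids `c`, its only neighbour of `v` is `b`, and only
  -- `x` on it sees `P` minus `a`.
  record Tail (Q : List V) (b c x : V) (R : List V) : Set where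
    field
      T    : List V
      path : Path x b T
      ⊆RQ  : ∀ {t} → t ∈ T → t ∈ R ⊎ (t ∈ Q × t ≢ c)

  -- The single contacts with `a` and with `c` let `S` close to a hole both with `v` and, when it
  -- misses `x`, with `P`. Which of `s` and `t` lies nearer to `x` along `R` is left open.
  record Segment (a c : V) (R : List V) (s t : V) (S : List V) : Set where
    field
      route : Route s t S
      ⊆R    : ∀ {z} → z ∈ S → z ∈ R
      as    : a ~ s
      ct    : c ~ t
      onlyᵃ : ∀ {z} → z ∈ S → a ~ z → z ≡ s
      onlyᶜ : ∀ {z} → z ∈ S → c ~ z → z ≡ t

  rotateˢ : ∀ {a c R s t S} → Segment a c R s t S → Segment c a R t s S
  rotateˢ σ = record { route = swap route ; ⊆R = ⊆R ; as = ct ; ct = as ; onlyᵃ = onlyᶜ ; onlyᶜ = onlyᵃ }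
    where open Segment σ

  -- Parities of the holes formed with a link

  module _ {v a b c d P Q} (F : Frame v a b c d P Q) where
    open Frame F

    -- `P` closes to a hole with the one-vertex path `v`, which is odd.
    oddP : odd P ≡ true
    oddP = equalParity perfect (inj₁ pathP) (inj₁ [-]) (~-sym va) (~-sym vd)
      (λ { i (here refl) e → [ (λ p → inj₁ (p , refl)) , (λ p → inj₂ (p , refl)) ]′ (nbrP i (~-sym e)) })
      (λ p → contradiction p (proj₁ a∥d)) (λ _ → proj₂ a∥d)

    a∥c : a ∥ c
    a∥c = (λ { refl → P#Q (first∈ pathP , first∈ pathQ) }) , nonadj
      where
      nonadj : ¬ a ~ c
      nonadj e with joinsPQ (first∈ pathP) (first∈ pathQ) e
      ... | inj₁ (_ , p) = proj₁ c∥b p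
      ... | inj₂ (p , _) = proj₁ a∥d p

    path-∷ʳc : ∀ {w W} → Path w d (w ∷ W) → (∀ {s} → s ∈ w ∷ W → s ∈ P) → a ∉ w ∷ W → Path w c (w ∷ W ∷ʳ c)
    path-∷ʳc {w} {W} π ⊆P a∉ = path-∷ʳ π (~-sym cd) (λ i → P#Q (⊆P i , first∈ pathQ)) only
      where
      only : ∀ {u} → u ∈ w ∷ W → u ~ c → u ≡ d
      only i e with joinsPQ (⊆P i) (first∈ pathQ) e
      ... | inj₁ (refl , _) = contradiction i a∉
      ... | inj₂ (p , _)    = p

    P∷ʳc : Path a c (P ∷ʳ c)
    P∷ʳc = path-∷ʳ pathP (~-sym cd) (λ i → P#Q (i , first∈ pathQ)) only
      where
      only : ∀ {u} → u ∈ P → u ~ c → u ≡ d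
      only i e with joinsPQ i (first∈ pathQ) e
      ... | inj₁ (_ , p) = contradiction p (proj₁ c∥b)
      ... | inj₂ (p , _) = p

  module _ {v a b c d P Q x y R} (F : Frame v a b c d P Q) (L : Link v a c P Q x y R) where
    open Frame F
    open Link L

    x∈R : x ∈ R
    x∈R = proj₁ (routeEnds routeR)

    nbrR-only : ∀ {w W} → LastNbr P a d x w W → ∀ {s z} → s ∈ w ∷ W → z ∈ R → s ~ z → s ≡ w × z ≡ x
    nbrR-only ν i j e
      with refl ← nbrPR j (LastNbr.⊆P ν i) (λ { refl → LastNbr.a∉ ν i }) (~-sym e)
      = LastNbr.only ν i (~-sym e) , refl

    tail : Tail Q b c x R
    -- `Q` runs from `c` to `b`, so the last neighbour of `y` is the one nearest to `b`; entering
    -- `Q` there leaves no chord at `y`.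
    tail with lastHit? (λ u → ¬? (u ≟ c) ×-dec (y ~? u)) Q | yQ | orient routeR | pathQ
    ... | inj₁ nQ | u , i , u≢c , e | _ | _ = contradiction (u≢c , e) (All.lookup nQ i)
    ... | inj₂ (lastHit Z′ z Z (z≢c , yz) nZ) | _ | R′ , ρ , R′⊆R | κ = record
      { T = R′ ++ z ∷ Z
      ; path = path-++ ρ (splitʳ Z′ κ) yz (λ (i , j) → R#Q (R′⊆R i , ∈-++⁺ʳ Z′ j)) only
      ; ⊆RQ = place }
      where
      c∉ : c ∉ z ∷ Z
      c∉ (here refl) = z≢c refl
      c∉ (there j)   = first∉ Z′ κ j

      only : ∀ {s t} → s ∈ R′ → t ∈ z ∷ Z → s ~ t → s ≡ y × t ≡ z
      only i j e with nbrQR (R′⊆R i) (∈-++⁺ʳ Z′ j) (λ { refl → c∉ j }) e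
      only i (here refl) e | refl = refl , refl
      only i (there j)   e | refl = contradiction ((λ { refl → c∉ (there j) }) , e) (All.lookup nZ j)

      place : ∀ {t} → t ∈ R′ ++ z ∷ Z → t ∈ R ⊎ (t ∈ Z′ ++ z ∷ Z × t ≢ c)
      place i with ∈-++⁻ R′ i
      ... | inj₁ j = inj₁ (R′⊆R j)
      ... | inj₂ j = inj₂ (∈-++⁺ʳ Z′ j , λ { refl → c∉ j })

    open Tail tail renaming (path to pathT)

    x≢b : x ≢ b
    x≢b refl = R#Q (x∈R , last∈ pathQ)

    T#P : Disjoint T P
    T#P (i , j) with ⊆RQ i
    ... | inj₁ i′       = R#P (i′ , j)
    ... | inj₂ (i′ , _) = P#Q (j , i′)

    v∉T : v ∉ T
    v∉T i with ⊆RQ i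
    ... | inj₁ i′       = v∉R i′
    ... | inj₂ (i′ , _) = v∉Q i′

    nbrPT : ∀ {t p} → t ∈ T → p ∈ P → p ≢ a → t ~ p → t ≡ x
    nbrPT i j p≢a e with ⊆RQ i
    ... | inj₁ i′ = nbrPR i′ j p≢a e
    ... | inj₂ (i′ , t≢c) with joinsPQ j i′ (~-sym e)
    ...   | inj₁ (p≡a , _) = contradiction p≡a p≢a
    ...   | inj₂ (_ , t≡c) = contradiction t≡c t≢c

    nbr-aT : ∀ {t} → t ∈ T → a ~ t → t ∈ R ⊎ t ≡ b
    nbr-aT i e with ⊆RQ i
    ... | inj₁ i′ = inj₁ i′
    ... | inj₂ (i′ , t≢c) with joinsPQ (first∈ pathP) i′ e
    ...   | inj₁ (_ , t≡b) = inj₂ t≡b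
    ...   | inj₂ (_ , t≡c) = contradiction t≡c t≢c

    nbr-vT : ∀ {t} → t ∈ T → v ~ t → t ≡ b
    nbr-vT i e with ⊆RQ i
    ... | inj₁ i′ = contradiction e (v≁R i′)
    ... | inj₂ (i′ , t≢c) with nbrQ i′ e
    ...   | inj₁ t≡c = contradiction t≡c t≢c
    ...   | inj₂ t≡b = t≡b

    module _ {w W} (ν : LastNbr P a d x w W) where
      open LastNbr ν

      lastNbr-≢v : w ≢ v
      lastNbr-≢v refl = v∉P (⊆P (here refl))

      path-∷ʳv : Path w v (w ∷ W ∷ʳ v)
      path-∷ʳv = path-∷ʳ path (~-sym vd) (v∉P ∘ ⊆P) onlyᵛ
        where
        onlyᵛ : ∀ {u} → u ∈ w ∷ W → u ~ v → u ≡ d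
        onlyᵛ i e with nbrP (⊆P i) (~-sym e)
        ... | inj₁ refl = contradiction i a∉
        ... | inj₂ p    = p

      joins-last-T : Joins w v x b (w ∷ W ∷ʳ v) T
      joins-last-T i j e with ∈-∷ʳ⁻ (w ∷ W) i
      ... | inj₂ refl = inj₂ (refl , nbr-vT j e)
      ... | inj₁ i′ with refl ← nbrPT j (⊆P i′) (λ { refl → a∉ i′ }) (~-sym e) =
        inj₁ (only i′ (~-sym e) , refl)

      -- The hole w – P – d – v – b – T – x.
      odd-last-T : odd W ≡ odd T
      odd-last-T = trans (sym odd-W) (equalParity perfect (inj₁ path-∷ʳv) (inj₁ pathT) (~-sym xw) vb joins-last-T
        (λ p → contradiction p lastNbr-≢v) (λ p → contradiction p x≢b))
        where
        odd-W : odd (w ∷ W ∷ʳ v) ≡ odd W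
        odd-W rewrite odd-∷ʳ W v = not-involutive _

    module _ {u U} (φ : FirstNbr P a x u U) where
      open FirstNbr φ

      module _ (a≁R : ∀ {z} → z ∈ R → ¬ a ~ z) where

        joins-first-T : Joins a u b x (U ∷ʳ u) T
        joins-first-T {s} i j e with s ≟ a
        ... | no s≢a with refl ← nbrPT j (⊆P i) s≢a (~-sym e) = inj₂ (only i (~-sym e) , refl)
        ... | yes refl with nbr-aT j e
        ...   | inj₁ j′  = contradiction e (a≁R j′)
        ...   | inj₂ t≡b = inj₁ (refl , t≡b)

        -- The hole a – P – u – x – T – b.
        odd-first-T : not (odd U) ≡ odd T
        odd-first-T = trans (sym (odd-∷ʳ U u)) (equalParity perfect (inj₁ path) (inj₂ pathT) ab (~-sym xu) joins-first-T
          (λ { refl → λ _ → a≁R x∈R (~-sym xu) }) (λ { refl → contradiction refl x≢b }))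

      -- The hole v – a – P – u – x – w – P – d.
      odd-first-last : ∀ {w W} → LastNbr P a d x w W → (∀ {s t} → s ∈ U ∷ʳ u → t ∈ w ∷ W → s ∥ t) → odd U ≡ odd W
      odd-first-last {w} {W} ν sep =
        trans (sym odd-U) (trans (equalParity perfect (inj₁ v∷U) (inj₂ x∷W) vd (~-sym xu) joins
          (λ { refl → contradiction (⊆P (∈-∷ʳ⁺ U)) v∉P }) (λ { refl → contradiction (x∈R , last∈ pathP) R#P })) odd-W)
        where
        module ν = LastNbr ν

        odd-U : odd (v ∷ U ∷ʳ u) ≡ odd U
        odd-U rewrite odd-∷ʳ U u = not-involutive _

        odd-W : odd (x ∷ w ∷ W) ≡ odd W
        odd-W = not-involutive _

        onlyᵛ : ∀ {s} → s ∈ U ∷ʳ u → v ~ s → s ≡ a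
        onlyᵛ i e with nbrP (⊆P i) e
        ... | inj₁ p    = p
        ... | inj₂ refl = contradiction refl (proj₁ (sep i (last∈ ν.path)))

        v∷U : Path v u (v ∷ U ∷ʳ u)
        v∷U = path-∷ va path (v∉P ∘ ⊆P) onlyᵛ

        x∷W : Path x d (x ∷ w ∷ W)
        x∷W = path-∷ ν.xw ν.path (λ i → R#P (x∈R , ν.⊆P i)) ν.only

        joins : Joins v u d x (v ∷ U ∷ʳ u) (x ∷ w ∷ W)
        joins (here refl) (here refl) e = contradiction e (v≁R x∈R)
        joins (here refl) (there j)   e with nbrP (ν.⊆P j) e
        ... | inj₁ refl = contradiction j ν.a∉
        ... | inj₂ p    = inj₁ (refl , p)
        joins (there i)   (here refl) e = inj₂ (only i (~-sym e) , refl)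
        joins (there i)   (there j)   e = contradiction e (proj₂ (sep i j))

    -- Let `U` precede the first and `W` follow the last neighbour of `x` on `P`. The two holes
    -- through `T` give `W` the parity of `T` and `U` the opposite one. With a single neighbour this
    -- makes `P` even; with neighbours that are not consecutive, a further hole through `v` and `x`
    -- demands equal parity of `U` and `W`.
    a-meets-R : ¬ (∀ {z} → z ∈ R → ¬ a ~ z)
    a-meets-R a≁R with hits (x ~?_) P | xP
    ... | none nP | u , i , _ , e = All.lookup nP i e
    ... | one U u W eq nU xu nW | _ = odd-clash (odd U) (odd W)
            (trans (sym (odd-++ U (u ∷ W))) (trans (cong odd (sym eq)) (oddP F)))
            (odd-last-T (lastNbr U pathP eq u≢a xu nW)) (odd-first-T (firstNbr U pathP eq xu nU) a≁R)
      where
      u≢a : u ≢ a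
      u≢a refl = a≁R x∈R (~-sym xu)

      odd-clash : ∀ p q → p xor not q ≡ true → q ≡ odd T → not p ≡ odd T → ⊥
      odd-clash true  true  _ p q with () ← trans p (sym q)
      odd-clash false false _ p q with () ← trans p (sym q)
    ... | far U u m M w W eq nU xu xw nW | _ =
      not-¬ (sym (odd-first-last φ ν sep)) (trans (odd-last-T ν) (sym (odd-first-T φ a≁R)))
      where
      eq′ : P ≡ (U ++ u ∷ m ∷ M) ++ w ∷ W
      eq′ = trans eq (sym (++-assoc U (u ∷ m ∷ M) (w ∷ W)))
      φ = firstNbr U pathP eq xu nU
      ν = lastNbr (U ++ u ∷ m ∷ M) pathP eq′ (λ { refl → a≁R x∈R (~-sym xw) }) xw nW
      sep : ∀ {s t} → s ∈ U ∷ʳ u → t ∈ w ∷ W → s ∥ t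
      sep = far-∥ U (subst (Path a d) eq pathP)
    -- The triangles are `u`, `w`, `x` and `a`, `v`, `b`; they are joined by `P` from `u` back to
    -- `a`, by `P` from `w` to `d` and on to `v`, and by `T`.
    ... | two U u w W eq nU xu xw nW | _ = prismFree (prism
            (inj₂ φ.path) (inj₁ (path-∷ʳv ν)) (inj₁ pathT)
            (cut-edge U π) (~-sym xu) (~-sym xw) (~-sym va) ab vb
            (λ { refl → a≁R x∈R (~-sym xu) }) (lastNbr-≢v ν) x≢b
            first#last (λ (i , j) → T#P (j , φ.⊆P i)) last#T
            first-last (joins-swap (joins-first-T φ a≁R)) (joins-last-T ν))
      where
      π : Path a d (U ++ u ∷ w ∷ W)
      π = subst (Path a d) eq pathP
      φ = firstNbr U pathP eq xu nU
      module φ = FirstNbr φ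
      ν = lastNbr (U ∷ʳ u) pathP (trans eq (sym (++-assoc U (u ∷ []) (w ∷ W)))) (λ { refl → a≁R x∈R (~-sym xw) }) xw nW
      module ν = LastNbr ν

      first#last : Disjoint (U ∷ʳ u) (w ∷ W ∷ʳ v)
      first#last (i , j) with ∈-∷ʳ⁻ (w ∷ W) j
      ... | inj₁ j′   = cut-disjoint U π (i , j′)
      ... | inj₂ refl = v∉P (φ.⊆P i)

      last#T : Disjoint (w ∷ W ∷ʳ v) T
      last#T (i , j) with ∈-∷ʳ⁻ (w ∷ W) i
      ... | inj₁ i′   = T#P (j , ν.⊆P i′)
      ... | inj₂ refl = v∉T j

      first-last : Joins u a w v (U ∷ʳ u) (w ∷ W ∷ʳ v)
      first-last i j e with ∈-∷ʳ⁻ (w ∷ W) j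
      ... | inj₁ j′ = inj₁ (cut-~ U π i j′ e)
      ... | inj₂ refl with nbrP (φ.⊆P i) (~-sym e)
      ...   | inj₁ p    = inj₂ (p , refl)
      ...   | inj₂ refl = contradiction i (last∉ U π)

    no-common : ∀ {z} → z ∈ R → a ~ z → ¬ c ~ z
    no-common i az cz = no-4-cycle c₄ az (~-sym cz) (~-sym vc) va (a∥c F)
      ((λ { refl → v∉R i }) , λ e → v≁R i (~-sym e))

    -- The hole a – S – c – v.
    odd-segment : ∀ {s t S} → Segment a c R s t S → odd S ≡ true
    odd-segment {s} {t} {S} σ = sym (equalParity perfect
      (inj₁ (step (~-sym va) (a∥c F ∷ []) (step vc [] [-]))) route as ct joins
      (λ p → contradiction p (proj₁ (a∥c F))) (λ _ → proj₂ (a∥c F)))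
      where
      open Segment σ
      joins : Joins a c s t (a ∷ v ∷ c ∷ []) S
      joins (here refl)                 j e = inj₁ (refl , onlyᵃ j e)
      joins (there (here refl))         j e = contradiction e (v≁R (⊆R j))
      joins (there (there (here refl))) j e = inj₂ (refl , onlyᶜ j e)

    -- Otherwise S closes with c – d – P – a to an odd hole.
    x∈segment : ∀ {s t S} → Segment a c R s t S → x ∈ S
    x∈segment {s} {t} {S} σ with DecMembership._∈?_ _≟_ x S
    ... | yes i = i
    ... | no x∉ = contradiction (trans odd-S (odd-segment σ)) λ ()
      where
      open Segment σ
      joins : Joins a c s t (P ∷ʳ c) S
      joins {p} i j e with ∈-∷ʳ⁻ P i | p ≟ a
      ... | inj₂ refl | _        = inj₂ (refl , onlyᶜ j e)
      ... | inj₁ _    | yes refl = inj₁ (refl , onlyᵃ j e)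
      ... | inj₁ i′   | no p≢a with refl ← nbrPR (⊆R j) i′ p≢a (~-sym e) = contradiction j x∉

      odd-S : false ≡ odd S
      odd-S = trans (sym (trans (odd-∷ʳ P c) (cong not (oddP F))))
        (equalParity perfect (inj₁ (P∷ʳc F)) route as ct joins
          (λ p → contradiction p (proj₁ (a∥c F))) (λ _ → proj₂ (a∥c F)))

  -- The segment between `a` and `c` is all of `R`

  infix-spans : ∀ {x z zs} X {s M t} Y → Path x z zs → zs ≡ X ++ s ∷ M ++ t ∷ Y →
    x ∈ s ∷ M ∷ʳ t → z ∈ s ∷ M ∷ʳ t → zs ≡ s ∷ M ∷ʳ t
  infix-spans [] [] π refl i j = refl
  infix-spans [] {s} {M} (y ∷ Y) π refl i j = contradiction j (last∉ (s ∷ M) π)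
  infix-spans (u ∷ X) {s} {M} {t} Y π refl i j with path-head π
  ... | _ , refl = contradiction (∈-++⁺ʳ X (∷ʳ-⊆ (s ∷ M) refl i)) (head∉ π)

  module _ {v a b c d P Q x y R} (F : Frame v a b c d P Q) (L : Link v a c P Q x y R) where
    open Frame F
    open Link L

    y∈segment : ∀ {s t S} → Segment a c R s t S → y ∈ S
    y∈segment σ = x∈segment (rotate F) (rotateᴸ L) (rotateˢ σ)

    segment-spans : ∀ X {s M t} Y {e f} → R ≡ X ++ s ∷ M ++ t ∷ Y →
      Segment a c R e f (s ∷ M ∷ʳ t) → R ≡ s ∷ M ∷ʳ t
    segment-spans X Y eq σ with routeR
    ... | inj₁ ρ = infix-spans X Y ρ eq (x∈segment F L σ) (y∈segment σ)
    ... | inj₂ ρ = infix-spans X Y ρ eq (y∈segment σ) (x∈segment F L σ)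

    spanning-ends : ∀ {e f} → Segment a c R e f R → Segment a c R x y R ⊎ Segment a c R y x R
    spanning-ends σ with Segment.route σ | routeR
    ... | inj₁ ρ | inj₁ π with refl , refl ← path-ends ρ π = inj₁ σ
    ... | inj₁ ρ | inj₂ π with refl , refl ← path-ends ρ π = inj₂ σ
    ... | inj₂ ρ | inj₁ π with refl , refl ← path-ends ρ π = inj₂ σ
    ... | inj₂ ρ | inj₂ π with refl , refl ← path-ends ρ π = inj₁ σ

    -- The segment contains `x`, and by the half turn also `y`, so nothing of `R` remains outside
    -- it. Either `a` sees only `x` and `c` only `y` in `R`, or the other way round; `R` has no
    -- further contacts with `a` or `c`.
    spanning : Segment a c R x y R ⊎ Segment a c R y x R
    spanning with any? (a ~?_) R | any? (c ~?_) R
    ... | no noA | _ = ⊥-elim (a-meets-R F L λ i e → noA (Any.map (λ { refl → e }) i))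
    ... | yes _  | no noC = ⊥-elim (a-meets-R (rotate F) (rotateᴸ L) λ i e → noC (Any.map (λ { refl → e }) i))
    ... | yes hasA | yes hasC with closestPair (a ~?_) (c ~?_) R hasA hasC (no-common F L)
    ...   | closest X s M t Y eq nA nC ends = conclude ends
      where
      S = s ∷ M ∷ʳ t

      S⊆R : ∀ {z} → z ∈ S → z ∈ R
      S⊆R i = ++-⊆ʳ X eq (∷ʳ-⊆ (s ∷ M) refl i)

      path-S : Path s t S
      path-S with routeR
      ... | inj₁ ρ = infix-path X (subst (Path x y) eq ρ)
      ... | inj₂ ρ = infix-path X (subst (Path y x) eq ρ)

      s∈R : s ∈ R
      s∈R = S⊆R (here refl)

      t∈R : t ∈ R
      t∈R = S⊆R (there (∈-∷ʳ⁺ M))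

      extend : ∀ {e f} → Segment a c R e f S → Segment a c R x y R ⊎ Segment a c R y x R
      extend {e} {f} σ = spanning-ends (subst (Segment a c R e f) (sym (segment-spans X Y eq σ)) σ)

      conclude : a ~ s × c ~ t ⊎ c ~ s × a ~ t → Segment a c R x y R ⊎ Segment a c R y x R
      conclude (inj₁ (as , ct)) = extend (record
        { route = inj₁ path-S ; ⊆R = S⊆R ; as = as ; ct = ct
        ; onlyᵃ = only-first nA (λ at → no-common F L t∈R at ct)
        ; onlyᶜ = only-last nC (no-common F L s∈R as) })
      conclude (inj₂ (cs , at)) = extend (record
        { route = inj₂ path-S ; ⊆R = S⊆R ; as = at ; ct = cs
        ; onlyᵃ = only-last nA (λ as → no-common F L s∈R as cs)
        ; onlyᶜ = only-first nC (no-common F L t∈R at) })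

    segment-ends-≢ : ∀ {e f S} → Segment a c R e f S → e ≢ f
    segment-ends-≢ σ refl = no-common F L (⊆R (proj₁ (routeEnds route))) as ct
      where open Segment σ

    module _ (σ : Segment a c R x y R) where
      open Segment σ

      joins-last-R : ∀ {w W} → LastNbr P a d x w W → Joins w c x y (w ∷ W ∷ʳ c) R
      joins-last-R {w} {W} ν i j e with ∈-∷ʳ⁻ (w ∷ W) i
      ... | inj₁ i′   = inj₁ (nbrR-only F L ν i′ j e)
      ... | inj₂ refl = inj₂ (refl , onlyᶜ j e)

      -- The hole w – P – d – c – R.
      odd-last : ∀ {w W} → LastNbr P a d x w W → odd W ≡ true
      odd-last {w} {W} ν = trans (sym odd-W) (trans (equalParity perfect
          (inj₁ (path-∷ʳc F path′ ⊆P a∉)) routeR (~-sym xw) ct (joins-last-R ν)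
          (λ { refl → contradiction (⊆P (here refl) , first∈ pathQ) P#Q })
          (λ x≡y → contradiction x≡y (segment-ends-≢ σ)))
        (odd-segment F L σ))
        where
        open LastNbr ν renaming (path to path′) hiding (only)
        odd-W : odd (w ∷ W ∷ʳ c) ≡ odd W
        odd-W rewrite odd-∷ʳ W c = not-involutive _

      a-first : ∀ U {u U′} → P ≡ U ++ u ∷ U′ → All (λ s → ¬ x ~ s) U → U ≡ [] × u ≡ a
      a-first []      eq nU = refl , sym (just-injective (trans (sym (cong head (proj₂ (path-head pathP)))) (cong head eq)))
      a-first (s ∷ U) eq (x≁s ∷ _) with just-injective (trans (sym (cong head (proj₂ (path-head pathP)))) (cong head eq))
      ... | refl = contradiction (~-sym as) x≁s

      -- As `a` sees `x`, the first neighbour of `x` on `P` is `a`, and a `Link` provides another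
      -- one. If the last one, `w`, were not next to `a`, the hole through `v`, `a`, `x`, `w` and
      -- `d` would make `W` even, against `odd-last`.
      nbrs-start : ∃[ w ] ∃[ W ] P ≡ a ∷ w ∷ W × LastNbr P a d x w W
      nbrs-start with hits (x ~?_) P | xP
      ... | none nP | u , i , _ , e = contradiction e (All.lookup nP i)
      ... | one U u W eq nU xu nW | u′ , i , u′≢a , e with refl , refl ← a-first U eq nU with subst (u′ ∈_) eq i
      ...   | here p  = contradiction p u′≢a
      ...   | there j = contradiction e (All.lookup nW j)
      nbrs-start | two U u w W eq nU xu xw nW | _ with refl , refl ← a-first U eq nU =
        w , W , eq , lastNbr (a ∷ []) pathP eq w≢a xw nW
        where
        w≢a : w ≢ a
        w≢a refl = head∉ (subst (Path a d) eq pathP) (here refl)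
      nbrs-start | far U u m M w W eq nU xu xw nW | _ with refl , refl ← a-first U eq nU =
        contradiction (trans (odd-first-last F L (firstNbr [] pathP eq xu []) ν (far-∥ [] π)) (odd-last ν)) λ ()
        where
        π = subst (Path a d) eq pathP
        w≢a : w ≢ a
        w≢a refl = head∉ π (there (∈-++⁺ʳ M (here refl)))
        ν = lastNbr (a ∷ m ∷ M) pathP eq w≢a xw nW

  -- The two prisms that exclude a link

  module _ {v a b c d P Q x y R} (F : Frame v a b c d P Q) (L : Link v a c P Q x y R) where
    open Frame F
    open Link L

    not-aligned : ¬ Segment a c R x y R
    not-aligned σ with nbrs-start F L σ | nbrs-start (rotate F) (rotateᴸ L) (rotateˢ σ)
    -- The triangles are `a`, `x`, `w` and `q`, `y`, `c`. The paths are `Q` minus `c` prolonged from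
    -- `b` to `a`, then `R`, then `P` minus `a` prolonged from `d` to `c`.
    ... | w , W , eqP , ν | q , Q′ , eqQ , κ = prismFree (prism
            (inj₂ (path-∷ʳc (rotate F) κ.path κ.⊆P κ.a∉)) routeR (inj₁ (path-∷ʳc F ν.path ν.⊆P ν.a∉))
            as aw ν.xw (~-sym κ.xw) (~-sym cq) (~-sym ct)
            (λ { refl → P#Q (first∈ pathP , κ.⊆P (here refl)) }) (segment-ends-≢ F L σ)
            (λ { refl → P#Q (ν.⊆P (here refl) , first∈ pathQ) })
            Q#R Q#P R#P′
            (joins-swap (joins-last-R (rotate F) (rotateᴸ L) (rotateˢ σ) κ))
            joins
            (joins-flip (joins-last-R F L σ ν)))
      where
      open Segment σ
      module ν = LastNbr ν
      module κ = LastNbr κ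
      pathP′ = subst (Path a d) eqP pathP
      pathQ′ = subst (Path c b) eqQ pathQ

      aw : a ~ w
      aw = cut-edge [] pathP′

      cq : c ~ q
      cq = cut-edge [] pathQ′

      Q#R : Disjoint (q ∷ Q′ ∷ʳ a) R
      Q#R (i , j) with ∈-∷ʳ⁻ (q ∷ Q′) i
      ... | inj₁ i′   = R#Q (j , κ.⊆P i′)
      ... | inj₂ refl = R#P (j , first∈ pathP)

      R#P′ : Disjoint R (w ∷ W ∷ʳ c)
      R#P′ (i , j) with ∈-∷ʳ⁻ (w ∷ W) j
      ... | inj₁ j′   = R#P (i , ν.⊆P j′)
      ... | inj₂ refl = R#Q (i , first∈ pathQ)

      Q#P : Disjoint (q ∷ Q′ ∷ʳ a) (w ∷ W ∷ʳ c)
      Q#P (i , j) with ∈-∷ʳ⁻ (q ∷ Q′) i | ∈-∷ʳ⁻ (w ∷ W) j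
      ... | inj₁ i′   | inj₁ j′   = P#Q (ν.⊆P j′ , κ.⊆P i′)
      ... | inj₁ i′   | inj₂ refl = κ.a∉ i′
      ... | inj₂ refl | inj₁ j′   = ν.a∉ j′
      ... | inj₂ refl | inj₂ a≡c  = proj₁ (a∥c F) a≡c

      joins : Joins a q w c (q ∷ Q′ ∷ʳ a) (w ∷ W ∷ʳ c)
      joins i j e with ∈-∷ʳ⁻ (q ∷ Q′) i | ∈-∷ʳ⁻ (w ∷ W) j
      ... | inj₁ i′   | inj₂ refl = inj₂ (nbr-head pathQ′ (there i′) (~-sym e) , refl)
      ... | inj₂ refl | inj₁ j′   = inj₁ (refl , nbr-head pathP′ (there j′) e)
      ... | inj₂ refl | inj₂ refl = contradiction e (proj₂ (a∥c F))
      ... | inj₁ i′   | inj₁ j′ with joinsPQ (ν.⊆P j′) (κ.⊆P i′) (~-sym e)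
      ...   | inj₁ (refl , _) = contradiction j′ ν.a∉
      ...   | inj₂ (_ , refl) = contradiction i′ κ.a∉

    module _ (σ : Segment a c R y x R) where
      open Segment σ

      x≢y : x ≢ y
      x≢y = segment-ends-≢ F L σ ∘ sym

      x≁a : ¬ x ~ a
      x≁a e = x≢y (onlyᵃ (x∈R F L) (~-sym e))

      joins-first-R : ∀ {U u} → FirstNbr P a x u U → Joins a u y x (U ∷ʳ u) R
      joins-first-R φ {s} i j e with s ≟ a
      ... | yes refl = inj₁ (refl , onlyᵃ j e)
      ... | no s≢a with refl ← nbrPR j (FirstNbr.⊆P φ i) s≢a (~-sym e) = inj₂ (FirstNbr.only φ i (~-sym e) , refl)

      -- The hole a – P – u – R.
      even-first : ∀ {U u} → FirstNbr P a x u U → not (odd U) ≡ true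
      even-first {U} {u} φ = trans (sym (odd-∷ʳ U u)) (trans
        (equalParity perfect (inj₁ path) (swap routeR) as (~-sym xu) (joins-first-R φ)
          (λ { refl → contradiction xu x≁a }) (λ y≡x → contradiction (sym y≡x) x≢y))
        (odd-segment F L σ))
        where open FirstNbr φ

      x∷Q : Path x b (x ∷ Q)
      x∷Q = path-∷ (~-sym ct) pathQ (λ i → R#Q (x∈R F L , i)) only-c
        where
        only-c : ∀ {t} → t ∈ Q → x ~ t → t ≡ c
        only-c {t} i e with t ≟ c
        ... | yes t≡c = t≡c
        ... | no t≢c  = contradiction (nbrQR (x∈R F L) i t≢c e) x≢y

      -- The hole a – P – u – x – c – Q – b.
      odd-first : ∀ {U u} → FirstNbr P a x u U → d ∉ U ∷ʳ u → not (odd U) ≡ false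
      odd-first {U} {u} φ d∉ = trans (sym (odd-∷ʳ U u)) (trans
        (equalParity perfect (inj₁ path) (inj₂ x∷Q) ab (~-sym xu) joins
          (λ { refl → contradiction xu x≁a }) (λ { refl → contradiction (x∈R F L , last∈ pathQ) R#Q }))
        (cong not (oddP (rotate F))))
        where
        open FirstNbr φ
        joins : Joins a u b x (U ∷ʳ u) (x ∷ Q)
        joins i (here refl) e = inj₂ (only i (~-sym e) , refl)
        joins i (there j)   e with joinsPQ (⊆P i) j e
        ... | inj₁ p          = inj₁ p
        ... | inj₂ (refl , _) = contradiction i d∉

      -- Let `u` be the first neighbour of `x` on `P`. Closing the part of `P` up to `u` by `R` and
      -- closing it by `x` and `Q` ask for opposite parities. The second cycle is a hole unless the
      -- part reaches `d`, whose edge to `c` is then a chord; so `u` is `d`.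
      nbr-d : x ~ d × (∀ {t} → t ∈ P → x ~ t → t ≡ d)
      nbr-d with firstHit? (x ~?_) P | xP
      ... | inj₁ nP | u , i , _ , e = contradiction e (All.lookup nP i)
      ... | inj₂ h | _ = fromHit h refl
        where
        fromHit : ∀ {P′} → FirstHit (x ~_) P′ → P ≡ P′ → x ~ d × (∀ {t} → t ∈ P → x ~ t → t ≡ d)
        fromHit (firstHit U u [] nU xu) eq with refl ← eq with φ ← firstNbr U pathP eq xu nU
          with _ , refl ← path-ends (FirstNbr.path φ) pathP = xu , FirstNbr.only φ
        fromHit (firstHit U u (m ∷ U′) nU xu) eq =
          contradiction (trans (sym (odd-first φ (last∉ U (subst (Path a d) eq pathP)))) (even-first φ)) λ ()
          where φ = firstNbr U pathP eq xu nU

      joins-PR : Joins a d y x P R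
      joins-PR {s} i j e with s ≟ a
      ... | yes refl = inj₁ (refl , onlyᵃ j e)
      ... | no s≢a with refl ← nbrPR j i s≢a (~-sym e) = inj₂ (proj₂ nbr-d i (~-sym e) , refl)

  module _ {v a b c d P Q x y R} (F : Frame v a b c d P Q) (L : Link v a c P Q x y R) where
    open Frame F
    open Link L

    not-crossed : ¬ Segment a c R y x R
    -- The triangles are `a`, `b`, `y` and `d`, `c`, `x`; that `b` sees `y` is the half turn of `d`
    -- seeing `x`.
    not-crossed σ = prismFree (prism
      (inj₁ pathP) (inj₂ pathQ) (swap routeR)
      ab as (~-sym (proj₁ (nbr-d (rotate F) (rotateᴸ L) (rotateˢ σ))))
      (~-sym cd) (~-sym (proj₁ (nbr-d F L σ))) ct
      (proj₁ a∥d) (proj₁ c∥b ∘ sym) (segment-ends-≢ F L σ)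
      P#Q (λ (i , j) → R#P (j , i)) (λ (i , j) → R#Q (j , i))
      joinsPQ (joins-PR F L σ) (joins-swap (joins-PR (rotate F) (rotateᴸ L) (rotateˢ σ))))
      where open Segment σ

    no-link : ⊥
    no-link = [ not-aligned F L , not-crossed ]′ (spanning F L)

  -- From arbitrary paths outside N[v] to links

  data Near (a : V) (P : List V) (z : V) : Set where
    near : ∀ {u} → u ∈ P → u ≢ a → u ≡ z ⊎ z ~ u → Near a P z

  near? : ∀ a P → Decidable (Near a P)
  near? a P z with any? (λ u → ¬? (u ≟ a) ×-dec ((u ≟ z) ⊎-dec (z ~? u))) P
  ... | yes h with u , i , u≢a , close ← find h = yes (near i u≢a close)
  ... | no ¬h = no λ { (near i u≢a close) → ¬h (lose i (u≢a , close)) }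

  -- Contacts are taken in the closed neighbourhoods because a path inside a component may enter `P`
  -- or `Q`. That it does not, once only its ends are near, has to be derived.
  record Reach (v a c : V) (P Q : List V) (x y : V) (R : List V) : Set where
    field
      route  : Route x y R
      v≁R    : ∀ {z} → z ∈ R → ¬ v ~ z
      v∉R    : v ∉ R
      nearP  : Near a P x
      nearQ  : Near c Q y
      onlyP  : ∀ {z} → z ∈ R → Near a P z → z ≡ x
      onlyQ  : ∀ {z} → z ∈ R → Near c Q z → z ≡ y

  rotateᴿ : ∀ {v a c P Q x y R} → Reach v a c P Q x y R → Reach v c a Q P y x R
  rotateᴿ ρ = record { route = swap route ; v≁R = v≁R ; v∉R = v∉R ; nearP = nearQ ; nearQ = nearP
                     ; onlyP = onlyQ ; onlyQ = onlyP }
    where open Reach ρ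

  last-nbr : ∀ {x y X} → Path y x X → x ≡ y ⊎ (∃[ z ] z ∈ X × x ~ z)
  last-nbr [-] = inj₁ refl
  last-nbr (step e _ π) with last-nbr π
  ... | inj₁ refl        = inj₂ (_ , here refl , ~-sym e)
  ... | inj₂ (z , i , f) = inj₂ (z , there i , f)

  route-nbr : ∀ {x y X} → Route x y X → x ≡ y ⊎ (∃[ z ] z ∈ X × x ~ z)
  route-nbr (inj₁ [-])          = inj₁ refl
  route-nbr (inj₁ (step e _ _)) = inj₂ (_ , there (here refl) , e)
  route-nbr (inj₂ π)            = last-nbr π

  -- A vertex of `R` on `P` is near, hence it is `x`. If `R` has another vertex, the neighbour of
  -- `x` in `R` is near as well, which is impossible. If `x` is all of `R`, it is also near `Q`;
  -- being off `Q`, it would be `a` or `d`, and these see `v`.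
  reach#P : ∀ {v a b c d P Q x y R} → Frame v a b c d P Q → Reach v a c P Q x y R → Disjoint R P
  reach#P {v} {a} {c = c} {d} {P} {Q} {x} {y} {R} F ρ (i , j) with refl ← Reach.onlyP ρ i (near j (λ { refl → Reach.v≁R ρ i (Frame.va F) }) (inj₁ refl))
    = clash (route-nbr route) nearQ
    where
    open Frame F
    open Reach ρ

    x≢a : x ≢ a
    x≢a refl = v≁R i va

    x≢d : x ≢ d
    x≢d refl = v≁R i vd

    clash : x ≡ y ⊎ (∃[ z ] z ∈ R × x ~ z) → Near c Q y → ⊥
    clash (inj₂ (z , k , e)) _ with refl ← onlyP k (near j x≢a (inj₂ (~-sym e))) = ~-irrefl refl e
    clash (inj₁ refl) (near k _ (inj₁ refl)) = P#Q (j , k)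
    clash (inj₁ refl) (near k _ (inj₂ e)) with joinsPQ j k e
    ... | inj₁ (p , _) = x≢a p
    ... | inj₂ (p , _) = x≢d p

  toLink : ∀ {v a b c d P Q x y R} → Frame v a b c d P Q → Reach v a c P Q x y R → Link v a c P Q x y R
  toLink F ρ = record
    { routeR = route
    ; xP = meets (reach#P F ρ) (proj₁ (routeEnds route)) nearP
    ; yQ = meets (reach#P (rotate F) (rotateᴿ ρ)) (proj₂ (routeEnds route)) nearQ
    ; nbrPR = λ i j u≢a e → onlyP i (near j u≢a (inj₂ e))
    ; nbrQR = λ i j u≢c e → onlyQ i (near j u≢c (inj₂ e))
    ; R#P = reach#P F ρ ; R#Q = reach#P (rotate F) (rotateᴿ ρ)
    ; v≁R = v≁R ; v∉R = v∉R }
    where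
    open Reach ρ
    meets : ∀ {e R S z} → Disjoint R S → z ∈ R → Near e S z → ∃[ u ] u ∈ S × u ≢ e × z ~ u
    meets dis i (near j u≢e (inj₁ refl)) = contradiction (i , j) dis
    meets dis i (near j u≢e (inj₂ e))    = _ , j , u≢e , e

  -- A vertex near both sides is a `Reach` by itself; otherwise a closest pair of near vertices
  -- along `R` bounds one, in either direction.
  no-path : ∀ {v a b c d P Q} → Frame v a b c d P Q → ∀ {s t R} → Path s t R →
    (∀ {z} → z ∈ R → ¬ v ~ z) → v ∉ R → Near a P s → Near c Q t → ⊥
  no-path {v} {a} {b} {c} {d} {P} {Q} F {s} {t} {R} π v≁R v∉R ns nt
    with any? (λ z → near? a P z ×-dec near? c Q z) R
  ... | yes h with z , i , np , nq ← find h = no-link F (toLink F (record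
        { route = inj₁ [-] ; v≁R = λ { (here refl) → v≁R i } ; v∉R = λ { (here refl) → v∉R i }
        ; nearP = np ; nearQ = nq ; onlyP = λ { (here p) _ → p } ; onlyQ = λ { (here p) _ → p } }))
  ... | no ¬h with closestPair (near? a P) (near? c Q) R (lose (first∈ π) ns) (lose (last∈ π) nt)
                     (λ i np nq → ¬h (lose i (np , nq)))
  ...   | closest X e M f Y eq nP nQ ends = conclude ends
    where
    S⊆R : ∀ {z} → z ∈ e ∷ M ∷ʳ f → z ∈ R
    S⊆R i = ++-⊆ʳ X eq (∷ʳ-⊆ (e ∷ M) refl i)

    path-S : Path e f (e ∷ M ∷ʳ f)
    path-S = infix-path X (subst (Path s t) eq π)

    excl : ∀ {z} → z ∈ e ∷ M ∷ʳ f → Near a P z → ¬ Near c Q z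
    excl i np nq = ¬h (lose (S⊆R i) (np , nq))

    e∈ : e ∈ e ∷ M ∷ʳ f
    e∈ = here refl

    f∈ : f ∈ e ∷ M ∷ʳ f
    f∈ = there (∈-∷ʳ⁺ M)

    conclude : Near a P e × Near c Q f ⊎ Near c Q e × Near a P f → ⊥
    conclude (inj₁ (np , nq)) = no-link F (toLink F (record
      { route = inj₁ path-S ; v≁R = v≁R ∘ S⊆R ; v∉R = v∉R ∘ S⊆R ; nearP = np ; nearQ = nq
      ; onlyP = only-first nP (λ np′ → excl f∈ np′ nq) ; onlyQ = only-last nQ (excl e∈ np) }))
    conclude (inj₂ (nq , np)) = no-link F (toLink F (record
      { route = inj₂ path-S ; v≁R = v≁R ∘ S⊆R ; v∉R = v∉R ∘ S⊆R ; nearP = np ; nearQ = nq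
      ; onlyP = only-last nP (λ np′ → excl e∈ np′ nq) ; onlyQ = only-first nQ (excl f∈ np) }))

  -- Deriving both conclusions within a frame

  walk⇒path : ∀ {W : Pred V 0ℓ} {s t} → Star (λ u w → W u × W w × u ~ w) s t → W s →
    ∃[ R ] Path s t R × (∀ {z} → z ∈ R → W z)
  walk⇒path ε ws = _ , [-] , λ { (here refl) → ws }
  walk⇒path {W} {s} {t} (_◅_ {j = y} (_ , wy , e) walk) ws with walk⇒path walk wy
  ... | R , π , R⊆W with DecMembership._∈?_ _≟_ s R
  ...   | yes i with X , Y , refl ← ∈-∃++ i = _ , splitʳ X π , R⊆W ∘ ∈-++⁺ʳ X
  ...   | no s∉ with lastHit? (s ~?_) R
  ...     | inj₁ nR = contradiction e (All.lookup nR (first∈ π))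
  -- Jumping to the last neighbour of `s` leaves no chord at `s`.
  ...     | inj₂ (lastHit X w Y sw nY) =
    s ∷ w ∷ Y , path-∷ sw (splitʳ X π) (s∉ ∘ ∈-++⁺ʳ X) only , λ { (here refl) → ws ; (there i) → R⊆W (∈-++⁺ʳ X i) }
    where
    only : ∀ {z} → z ∈ w ∷ Y → s ~ z → z ≡ w
    only (here p)  _ = p
    only (there i) f = contradiction f (All.lookup nY i)

  -- If N[D] contained the set, then `d`, which sees `v` and so is not in `D`, would have a
  -- neighbour in `D`, and `q` would lie in or next to `D`. A path inside `D` between these contacts
  -- avoids N[v], which `no-path` forbids.
  breaks : ∀ {v a b c d P Q} → Frame v a b c d P Q → ∀ {x y S} → (∀ {s} → s ∈ S → s ∈ Q) →
    ∃[ q ] Interior x y S q × q ≢ c → Breaks G v (｛ d ｝ ∪ Interior x y S)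
  breaks {v} {a} {c = c} {d} {P} {Q} F {x} {y} {S} S⊆Q (q , q∈ , q≢c) = v∉Y , no-component
    where
    open Frame F

    v∉Y : ¬ (｛ d ｝ ∪ Interior x y S) v
    v∉Y (inj₁ refl)    = ~-irrefl refl vd
    v∉Y (inj₂ (i , _)) = v∉Q (S⊆Q i)

    no-component : ∀ D → IsComponent G (∁ (N[_] G ｛ v ｝)) D →
      ¬ ((｛ d ｝ ∪ Interior x y S) ⊆ N[_] G (_∈ˢ D))
    no-component D comp Y⊆ with Y⊆ (inj₁ refl) | Y⊆ (inj₂ q∈)
    ... | inj₁ d∈D           | _ = IsComponent.inside comp d∈D (inj₂ (v , refl , ~-sym vd))
    ... | inj₂ (w , w∈D , e) | nq = join nq
      where
      v≁D : ∀ {z} → z ∈ˢ D → ¬ v ~ z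
      v≁D i f = IsComponent.inside comp i (inj₂ (v , refl , ~-sym f))

      v∉D : ¬ v ∈ˢ D
      v∉D i = IsComponent.inside comp i (inj₁ refl)

      nearD : Near a P w
      nearD = near (last∈ pathP) (proj₁ a∥d ∘ sym) (inj₂ (~-sym e))

      blocked : ∀ {z} → z ∈ˢ D → ¬ Near c Q z
      blocked z∈ nq with walk⇒path (IsComponent.connected comp w∈D z∈) w∈D
      ... | R , π , R⊆D = no-path F π (v≁D ∘ R⊆D) (v∉D ∘ R⊆D) nearD nq

      join : N[_] G (_∈ˢ D) q → ⊥
      join (inj₁ q∈D)           = blocked q∈D (near (S⊆Q (proj₁ q∈)) q≢c (inj₁ refl))
      join (inj₂ (z , z∈D , f)) = blocked z∈D (near (S⊆Q (proj₁ q∈)) q≢c (inj₂ (~-sym f)))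

  -- `v` alone links the two sets as soon as they contain `d` and `b`, and it does not see itself;
  -- this explains the requirement `v ∉ R`.
  linkMeetsNbr : ∀ {v a b c d P Q P′ Q′} → Frame v a b c d P Q →
    (∀ {s} → s ∈ P′ → s ∈ P) → (∀ {s} → s ∈ Q′ → s ∈ Q) →
    ∀ R → IsPathBetween G (Vertices P′ ∖ ｛ a ｝) (Vertices Q′ ∖ ｛ c ｝) R →
    v ∉ R → HasNeighbourIn G v (Vertices R)
  linkMeetsNbr {v} F P′⊆P Q′⊆Q R (links , _) v∉R with any? (v ~?_) R
  ... | yes h with z , i , e ← find h = z , i , e
  ... | no ¬h with Links.from links | Links.to links
  ...   | s , (i , a≢s) , e | t , (j , c≢t) , f =
    ⊥-elim (no-path F (fromIsPath (Links.path links)) (λ k g → ¬h (lose k g)) v∉R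
      (near (P′⊆P i) (a≢s ∘ sym) (inj₂ e)) (near (Q′⊆Q j) (c≢t ∘ sym) (inj₂ f)))

  -- The path could leave `X` only along `p`-`q`, but it avoids `q`, or along `z`-`r`, but it ends
  -- at `z`. This places the given paths, known only by their ends and the vertex they avoid, on the
  -- arcs of the listed hole.
  confined : ∀ {p z q r X Y x S} → Joins p z q r X Y → Path x z S → x ∈ X →
    (∀ {s} → s ∈ S → (s ∈ X ⊎ s ∈ Y) × s ≢ q) → ∀ {s} → s ∈ S → s ∈ X
  confined J π i S⊆ (here refl) with path-head π
  ... | _ , refl = i
  confined J π@(step e _ ρ) i S⊆ (there k) = confined J ρ next (S⊆ ∘ there) k
    where
    next : _ ∈ _
    next with S⊆ (there (here refl))
    ... | inj₁ j , _   = j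
    ... | inj₂ j , y≢q with J i j e
    ...   | inj₁ (_ , y≡q)  = contradiction y≡q y≢q
    ...   | inj₂ (refl , _) = contradiction (last∈ ρ) (head∉ π)

  interior : ∀ {x z S} → Path x z S → x ∥ z → ∃[ y ] y ∈ S × y ≢ x × y ≢ z
  interior [-] (x≢x , _) = contradiction refl x≢x
  interior (step {y = y} e _ _) (_ , x≁z) = y , there (here refl) , (λ { refl → ~-irrefl refl e }) , λ { refl → x≁z e }

  -- The line wheel itself

  module _ {h s t} (hole : IsHole G (h ∷ s ∷ t)) where
    open IsHole hole

    private
      H : List V
      H = h ∷ s ∷ t

    hole-head∉ : h ∉ s ∷ t
    hole-head∉ = unique-head∉ unique

    hole-~ : ∀ {u w} → Contiguous (u ∷ w ∷ []) (H ++ H) → u ~ w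
    hole-~ c = Equivalence.from (induced (in-H (proj₁ (contiguous-∈ c))) (in-H (proj₂ (contiguous-∈ c)))) (inj₁ c)
      where
      in-H : ∀ {z} → z ∈ H ++ H → z ∈ H
      in-H i = [ id , id ]′ (∈-++⁻ H i)

    contiguous-tail : ∀ {u w} → u ≢ h → w ≢ h → Contiguous (u ∷ w ∷ []) (H ++ H) → Contiguous (u ∷ w ∷ []) (s ∷ t)
    contiguous-tail u≢h w≢h c with contiguous-++⁻ H {h} {s ∷ t} c
    ... | inj₁ c′               = contiguous-uncons u≢h c′
    ... | inj₂ (inj₁ c′)        = contiguous-uncons u≢h c′
    ... | inj₂ (inj₂ (_ , w≡h)) = contradiction w≡h w≢h

    -- Cyclically consecutive pairs that avoid `h` are consecutive in the rest of the list, so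
    -- opening the hole at `h` leaves an induced path.
    hole-tail : ∀ {e} → last (s ∷ t) ≡ just e → Path s e (s ∷ t)
    hole-tail eq = fromIsPath (record
      { starts = refl ; ends = eq ; unique = unique-tail unique
      ; induced = λ i j → mk⇔
          (λ e → [ inj₁ ∘ contiguous-tail (≢h i) (≢h j) , inj₂ ∘ contiguous-tail (≢h j) (≢h i) ]′
                   (Equivalence.to (induced (there i) (there j)) e))
          [ hole-~ ∘ (λ c → there c ⁱ++ H) , (λ c → ~-sym (hole-~ (there c ⁱ++ H))) ]′ })
      where
      ≢h : ∀ {z} → z ∈ s ∷ t → z ≢ h
      ≢h i refl = hole-head∉ i

    hole-first : h ~ s
    hole-first = hole-~ (here (refl ∷ refl ∷ []))

    hole-closed : ∀ {e} → last (s ∷ t) ≡ just e → e ~ h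
    hole-closed eq = hole-~ (contiguous-join H eq)

    hole-nbr : ∀ {w} → w ∈ s ∷ t → h ~ w → w ≡ s ⊎ last (s ∷ t) ≡ just w
    hole-nbr i e with Equivalence.to (induced (here refl) (there i)) e
    ... | inj₁ c with contiguous-++⁻ H {h} {s ∷ t} c
    ...   | inj₁ c′                = inj₁ (contiguous-second hole-head∉ c′)
    ...   | inj₂ (inj₁ c′)         = inj₁ (contiguous-second hole-head∉ c′)
    ...   | inj₂ (inj₂ (_ , refl)) = contradiction i hole-head∉
    hole-nbr i e | inj₂ c with contiguous-++⁻ H {h} {s ∷ t} c
    ...   | inj₁ c′              = contradiction (contiguous-second∈ c′) hole-head∉
    ...   | inj₂ (inj₁ c′)       = contradiction (contiguous-second∈ c′) hole-head∉
    ...   | inj₂ (inj₂ (eq , _)) = inj₂ eq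

  module _ {v H} (lw : IsLineWheel G H v) where
    open IsLineWheel lw

    edge-sector : ∀ {x y} → Contiguous (x ∷ y ∷ []) (H ++ H) → x ~ y → v ~ x → v ~ y → IsSector G H v (x ∷ y ∷ [])
    edge-sector c e vx vy = c , _ , _ , [] , refl , toIsPath (step e [] [-]) , vx , vy , []

    short-sector : ∀ {S} → IsSector G H v S → Short G S → S ≡ S₁ ⊎ S ≡ S₂
    short-sector sec sh with Equivalence.to (sectors _) sec
    ... | here p                          = inj₁ p
    ... | there (here p)                  = inj₂ p
    ... | there (there (here refl))         = contradiction sh long₁
    ... | there (there (there (here refl))) = contradiction sh long₂

    -- An edge between `b` and `c`, or between `d` and `a`, would give a third short sector beside
    -- those on `a`, `b` and `c`, `d`; this is how both pairs are seen to be nonadjacent.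
    two-short : ∀ {S T U} → IsSector G H v S → IsSector G H v T → IsSector G H v U →
      Short G S → Short G T → Short G U → S ≢ T → S ≢ U → T ≢ U → ⊥
    two-short s t u sS sT sU S≢T S≢U T≢U with short-sector s sS | short-sector t sT | short-sector u sU
    ... | inj₁ p | inj₁ q | _      = S≢T (trans p (sym q))
    ... | inj₂ p | inj₂ q | _      = S≢T (trans p (sym q))
    ... | inj₁ p | inj₂ _ | inj₁ r = S≢U (trans p (sym r))
    ... | inj₂ p | inj₁ _ | inj₂ r = S≢U (trans p (sym r))
    ... | inj₁ _ | inj₂ q | inj₂ r = T≢U (trans q (sym r))
    ... | inj₂ _ | inj₁ q | inj₁ r = T≢U (trans q (sym r))

  module _ {v a b c d q p} (lw : IsLineWheel G (a ∷ b ∷ q ++ c ∷ d ∷ p) v)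
           (nbrs : ∀ x → x ∈ a ∷ b ∷ q ++ c ∷ d ∷ p → v ~ x ⇔ x ∈ a ∷ b ∷ c ∷ d ∷ []) where

    private
      H t : List V
      t = b ∷ q ++ c ∷ d ∷ p
      H = a ∷ t

      hole : IsHole G H
      hole = IsWheel.hole (IsLineWheel.wheel lw)

      c∈ : c ∈ H
      c∈ = there (there (∈-++⁺ʳ q (here refl)))

      d∈ : d ∈ H
      d∈ = there (there (∈-++⁺ʳ q (there (here refl))))

      va : v ~ a
      va = Equivalence.from (nbrs a (here refl)) (here refl)

      vb : v ~ b
      vb = Equivalence.from (nbrs b (there (here refl))) (there (here refl))

      vc : v ~ c
      vc = Equivalence.from (nbrs c c∈) (there (there (here refl)))

      vd : v ~ d
      vd = Equivalence.from (nbrs d d∈) (there (there (there (here refl))))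

      e : V
      e = proj₁ (last-just b (q ++ c ∷ d ∷ p))

      last-t : last t ≡ just e
      last-t = proj₂ (last-just b (q ++ c ∷ d ∷ p))

      path-t : Path b e t
      path-t = hole-tail hole last-t

      cd : c ~ d
      cd = cut-edge (b ∷ q) path-t

      a∉ : a ∉ t
      a∉ = hole-head∉ hole

      ab-sector : IsSector G H v (a ∷ b ∷ [])
      ab-sector = edge-sector lw (here (refl ∷ refl ∷ [])) (hole-first hole) va vb

      cd-sector : IsSector G H v (c ∷ d ∷ [])
      cd-sector = edge-sector lw (there (there (q ++ⁱ here (refl ∷ refl ∷ []))) ⁱ++ H) cd vc vd

      ab≢cd : _≢_ {A = List V} (a ∷ b ∷ []) (c ∷ d ∷ [])
      ab≢cd refl = a∉ (there (∈-++⁺ʳ q (here refl)))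

    b∥c : b ∥ c
    b∥c = b≢c , b≁c
      where
      b≢c : b ≢ c
      b≢c refl = head∉ path-t (∈-++⁺ʳ q (here refl))

      b≁c : ¬ b ~ c
      b≁c bc = consecutive refl
        where
        consecutive : ∀ {q′} → q′ ≡ q → ⊥
        consecutive {[]} refl = two-short lw ab-sector cd-sector
          (edge-sector lw (there (here (refl ∷ refl ∷ []))) bc vb vc) refl refl refl
          ab≢cd (λ { refl → a∉ (here refl) }) (λ { refl → ~-irrefl refl bc })
        consecutive {x ∷ q′} refl with splitˡ (b ∷ q) path-t
        ... | step _ ns _ = proj₂ (All.lookup ns (∈-∷ʳ⁺ q′)) bc

    a∥d : a ∥ d
    a∥d = (λ { refl → a∉ (there (∈-++⁺ʳ q (there (here refl)))) }) , a≁d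
      where
      a≁d : ¬ a ~ d
      a≁d ad with hole-nbr hole (there (∈-++⁺ʳ q (there (here refl)))) ad
      ... | inj₁ refl = head∉ path-t (∈-++⁺ʳ q (there (here refl)))
      ... | inj₂ last≡d = two-short lw ab-sector cd-sector
          (edge-sector lw (contiguous-join H last≡d) (~-sym ad) vd va) refl refl refl
          ab≢cd (λ { refl → ~-irrefl refl ad }) (λ { refl → ~-irrefl refl cd })

    private
      pathQ : Path b c (b ∷ q ∷ʳ c)
      pathQ = splitˡ (b ∷ q) path-t

      Q#dp : Disjoint (b ∷ q ∷ʳ c) (d ∷ p)
      Q#dp = cut-disjoint (b ∷ q) path-t

      dp⊆t : ∀ {u} → u ∈ d ∷ p → u ∈ t
      dp⊆t i = ∈-++⁺ʳ (b ∷ q) (there i)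

      Q⊆t : ∀ {u} → u ∈ b ∷ q ∷ʳ c → u ∈ t
      Q⊆t = ∷ʳ-⊆ (b ∷ q) refl

      path-dp : Path d e (d ∷ p)
      path-dp = last-cut (b ∷ q) path-t

      nbr-a : ∀ {u} → u ∈ t → a ~ u → u ≡ b ⊎ u ≡ e
      nbr-a i f with hole-nbr hole i f
      ... | inj₁ p = inj₁ p
      ... | inj₂ p = inj₂ (just-injective (trans (sym p) last-t))

      pathP : Path d a (d ∷ p ∷ʳ a)
      pathP = path-∷ʳ path-dp (hole-closed hole last-t) (a∉ ∘ dp⊆t) only
        where
        only : ∀ {u} → u ∈ d ∷ p → u ~ a → u ≡ e
        only i f with nbr-a (dp⊆t i) (~-sym f)
        ... | inj₁ refl = contradiction (here refl , i) Q#dp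
        ... | inj₂ u≡e  = u≡e

      joins : Joins d a c b (d ∷ p ∷ʳ a) (b ∷ q ∷ʳ c)
      joins i j f with ∈-∷ʳ⁻ (d ∷ p) i
      ... | inj₁ i′ with s≡c , t≡d ← cut-~ (b ∷ q) path-t j i′ (~-sym f) = inj₁ (t≡d , s≡c)
      ... | inj₂ refl with nbr-a (Q⊆t j) f
      ...   | inj₁ u≡b  = inj₂ (refl , u≡b)
      ...   | inj₂ refl = contradiction (j , last∈ path-dp) Q#dp

      P#Q : Disjoint (d ∷ p ∷ʳ a) (b ∷ q ∷ʳ c)
      P#Q (i , j) with ∈-∷ʳ⁻ (d ∷ p) i
      ... | inj₁ i′   = Q#dp (j , i′)
      ... | inj₂ refl = a∉ (Q⊆t j)

      P⊆H : ∀ {u} → u ∈ d ∷ p ∷ʳ a → u ∈ H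
      P⊆H i with ∈-∷ʳ⁻ (d ∷ p) i
      ... | inj₁ i′   = there (dp⊆t i′)
      ... | inj₂ refl = here refl

      v∉P : v ∉ d ∷ p ∷ʳ a
      v∉P i with ∈-∷ʳ⁻ (d ∷ p) i
      ... | inj₁ i′   = proj₁ b∥c (proj₁ (cut-~ (b ∷ q) path-t (here refl) i′ (~-sym vb)))
      ... | inj₂ refl = ~-irrefl refl va

      v∉Q : v ∉ b ∷ q ∷ʳ c
      v∉Q i with nbr-a (Q⊆t i) (~-sym va)
      ... | inj₁ refl = ~-irrefl refl vb
      ... | inj₂ refl = Q#dp (i , last∈ path-dp)

      nbrP : ∀ {u} → u ∈ d ∷ p ∷ʳ a → v ~ u → u ≡ d ⊎ u ≡ a
      nbrP i f with Equivalence.to (nbrs _ (P⊆H i)) f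
      ... | here p                          = inj₂ p
      ... | there (here refl)                 = contradiction (i , here refl) P#Q
      ... | there (there (here refl))         = contradiction (i , last∈ pathQ) P#Q
      ... | there (there (there (here p)))  = inj₁ p

      nbrQ : ∀ {u} → u ∈ b ∷ q ∷ʳ c → v ~ u → u ≡ b ⊎ u ≡ c
      nbrQ i f with Equivalence.to (nbrs _ (there (Q⊆t i))) f
      ... | here refl                           = contradiction (last∈ pathP , i) P#Q
      ... | there (here p)                    = inj₁ p
      ... | there (there (here p))            = inj₂ p
      ... | there (there (there (here refl))) = contradiction (here refl , i) P#Q

    -- The listing of the hole runs from `d` to `a` and from `b` to `c`, while a frame needs its two
    -- paths in the same sense around the hole. The frame that needs no reversal therefore starts at
    -- `d`.
    frame : Frame v d c b a (d ∷ p ∷ʳ a) (b ∷ q ∷ʳ c)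
    frame = record
      { pathP = pathP ; pathQ = pathQ ; ab = ~-sym cd ; cd = ~-sym (hole-first hole)
      ; va = vd ; vb = vc ; vc = vb ; vd = va
      ; a∥d = proj₁ a∥d ∘ sym , proj₂ a∥d ∘ ~-sym ; c∥b = b∥c
      ; joinsPQ = joins ; P#Q = P#Q ; nbrP = nbrP ; nbrQ = nbrQ ; v∉P = v∉P ; v∉Q = v∉Q }

    H⊆PQ : ∀ {u} → u ∈ H → u ∈ d ∷ p ∷ʳ a ⊎ u ∈ b ∷ q ∷ʳ c
    H⊆PQ (here refl)         = inj₁ (last∈ pathP)
    H⊆PQ (there (here refl)) = inj₂ (here refl)
    H⊆PQ (there (there i)) with ∈-++⁻ q i
    ... | inj₁ j           = inj₂ (there (∈-++⁺ˡ j))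
    ... | inj₂ (here refl) = inj₂ (last∈ pathQ)
    ... | inj₂ (there j)   = inj₁ (∈-++⁺ˡ j)


theorem5p4 : ∀ {n : ℕ} (G : Graph n) → C₄-free G → Prism-free G → Perfect G →
    ∀ (v a b c d : Fin n) (q p : List (Fin n)) →
    let H = a ∷ b ∷ q ++ c ∷ d ∷ p in
    IsLineWheel G H v →
    (∀ x → x ∈ H → Graph._~_ G v x ⇔ x ∈ (a ∷ b ∷ c ∷ d ∷ [])) →
    ∀ (P Q : List (Fin n)) →
    IsPath G a d P → Vertices P ⊆ Vertices H ∖ ｛ b ｝ →
    IsPath G b c Q → Vertices Q ⊆ Vertices H ∖ ｛ a ｝ →
    (∀ R → IsPathBetween G (Vertices P ∖ ｛ a ｝) (Vertices Q ∖ ｛ c ｝) R →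
    v ∉ R → HasNeighbourIn G v (Vertices R)) ×
    (∀ R → IsPathBetween G (Vertices P ∖ ｛ d ｝) (Vertices Q ∖ ｛ b ｝) R →
    v ∉ R → HasNeighbourIn G v (Vertices R)) ×
    Breaks G v (｛ a ｝ ∪ Interior b c Q) ×
    Breaks G v (｛ d ｝ ∪ Interior b c Q) ×
    Breaks G v (｛ b ｝ ∪ Interior a d P) ×
    Breaks G v (｛ c ｝ ∪ Interior a d P)
theorem5p4 G c₄ prismFree perfect v a b c d q p lw nbrs P Q isP P⊆ isQ Q⊆
  with x , x∈ , x≢a , x≢d ← LineWheels.interior G c₄ prismFree perfect (Paths.fromIsPath G isP) (LineWheels.a∥d G c₄ prismFree perfect lw nbrs)
     | y , y∈ , y≢b , y≢c ← LineWheels.interior G c₄ prismFree perfect (Paths.fromIsPath G isQ) (LineWheels.b∥c G c₄ prismFree perfect lw nbrs) =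
  -- `F₀` treats `P` minus `d` and `Q` minus `b`, its reflection `F₁` treats `P` minus `a` and `Q`
  -- minus `c`; their half turns exchange `P` and `Q` and give the two sets built on the interior of
  -- `P`.
  W.linkMeetsNbr F₁ (reverse⁺ ∘ P⊆P₀) (reverse⁺ ∘ Q⊆Q₀) ,
  W.linkMeetsNbr F₀ P⊆P₀ Q⊆Q₀ ,
  W.breaks F₀ Q⊆Q₀ (y , (y∈ , between y≢b y≢c) , y≢b) ,
  W.breaks F₁ (reverse⁺ ∘ Q⊆Q₀) (y , (y∈ , between y≢b y≢c) , y≢c) ,
  W.breaks (W.rotate F₁) (reverse⁺ ∘ P⊆P₀) (x , (x∈ , between x≢a x≢d) , x≢a) ,
  W.breaks (W.rotate F₀) P⊆P₀ (x , (x∈ , between x≢a x≢d) , x≢d)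
  where
  module W = LineWheels G c₄ prismFree perfect
  open Paths G using (fromIsPath; last∈; joins-flip)

  F₀ = W.frame lw nbrs
  F₁ = W.reflect F₀
  open W.Frame F₀ using (joinsPQ; pathP)

  P⊆P₀ : ∀ {s} → s ∈ P → s ∈ d ∷ p ∷ʳ a
  P⊆P₀ = W.confined (W.joins-swap joinsPQ) (fromIsPath isP) (last∈ pathP)
    (λ i → W.H⊆PQ lw nbrs (proj₁ (P⊆ i)) , proj₂ (P⊆ i) ∘ sym)

  Q⊆Q₀ : ∀ {s} → s ∈ Q → s ∈ b ∷ q ∷ʳ c
  Q⊆Q₀ = W.confined (W.joins-swap (joins-flip joinsPQ)) (fromIsPath isQ) (here refl)
    (λ i → swap (W.H⊆PQ lw nbrs (proj₁ (Q⊆ i))) , proj₂ (Q⊆ i) ∘ sym)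

  between : ∀ {s t u} → u ≢ s → u ≢ t → ¬ (｛ s ｝ ∪ ｛ t ｝) u
  between u≢s u≢t = [ u≢s ∘ sym , u≢t ∘ sym ]′
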